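{- Let $\mathcal{L}$ be a language of binding logic, and let $\Gamma\vdash\Delta$ be a sequent of propositions of $\mathcal{L}$. Then $\Gamma\vdash\Delta$ is provable in binding logic if and only if $\Gamma'\vdash\Delta'$ is provable in sequent calculus modulo the congruence generated by the rewrite system $\sigma$, where $\Gamma'=\{A' : A\in\Gamma\}$ and $\Delta'=\{A':A\in\Delta\}$.
   Context: Binding logic: a language is a set of function and predicate symbols each with a binding arity $\langle k_1,\ldots,k_n\rangle$; terms are variables and $f(x^1_1\cdots x^1_{k_1}\,t_1,\ldots,x^n_1\cdots x^n_{k_n}\,t_n)$ with the distinct variables $x^i_1,\ldots,x^i_{k_i}$ bound in $t_i$; atomic propositions $P(\ldots)$ are formed likewise; propositions are closed under $\Rightarrow,\wedge,\vee,\bot,\forall,\exists$; everything is up to $\alpha$-equivalence and $(t/x)A$ is substitution avoiding capture by quantifiers and by binding symbols. Proofs are in classical sequent calculus LK (multiset sequents, axiom, cut, contraction, weakening, logical rules, quantifier rules with this substitution and usual eigenvariable conditions). Target language $\mathcal{L}'$ (many-sorted predicate logic): sorts $n$ and $\langle n,p\rangle$ for natural numbers $n,p$. For each function symbol $f$ of binding arity $\langle k_1,\ldots,k_n\rangle$, symbols $f_p$ ($p\ge 0$) of rank $\langle k_1+p,\ldots,k_n+p\rangle\to p$; for each predicate symbol $P$ of binding arity $\langle k_1,\ldots,k_n\rangle$, a predicate $P$ of rank $\langle k_1,\ldots,k_n\rangle$; constants $1_n,\ldots,n_n$ of sort $n$; $[\,]_{n,p}$ of rank $\langle p,\langle n,p\rangle\rangle\to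 n$ (written $t[s]$); constants $id_n$ of sort $\langle n,n\rangle$; $\cdot_{n,p}$ of rank $\langle n,\langle n,p\rangle\rangle\to\langle n,p+1\rangle$ (written $t.s$); constants $\uparrow_n$ of sort $\langle n+1,n\rangle$; $\circ_{n,p,q}$ of rank $\langle\langle p,n\rangle,\langle q,p\rangle\rangle\to\langle q,n\rangle$. Variables of $\mathcal{L}$ are variables of sort $0$; $\uparrow^{m}$ abbreviates $\uparrow_0\circ\uparrow_1\circ\cdots\circ\uparrow_{m-1}$. Pre-cooking $F(\cdot,l)$ for a list $l$ of variables: $F(x,l)=n_{|l|}$ if $l_n=x$ and $l_p\neq x$ for $p<n$; $F(x,l)=x[\uparrow^{|l|}]$ if $x$ is not in $l$; $F(f(x^1_1\cdots x^1_{k_1}t_1,\ldots,x^n_1\cdots x^n_{k_n}t_n),l)=f_{|l|}(F(t_1,x^1_{k_1}\cdots x^1_1.l),\ldots,F(t_n,x^n_{k_n}\cdots x^n_1.l))$; $F(P(x^1_1\cdots x^1_{k_1}t_1,\ldots),\epsilon)=P(F(t_1,x^1_{k_1}\cdots x^1_1),\ldots)$; $F$ commutes with connectives and quantifiers ($F(\forall x A,\epsilon)=\forall x\,F(A,\epsilon)$ etc.). $A'=F(A,\epsilon)$, $t'=F(t,\epsilon)$. Rewrite system $\sigma$ (sort subscripts omitted, rules taken at all well-sorted instances): $n+1\to 1[\uparrow^n]$; $1[t.s]\to t$; $t[id]\to t$; $(t[s])[s']\to t[s\circ s']$; $id\circ s\to s$; $\uparrow\circ(t.s)\to s$; $(s_1\circ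 s_2)\circ s_3\to s_1\circ(s_2\circ s_3)$; $(t.s)\circ s'\to t[s'].(s\circ s')$; $s\circ id\to s$; $1.\uparrow\to id$; $1[s].(\uparrow\circ s)\to s$; and $f_p(t_1,\ldots,t_n)[s]\to f_q(t_1[1.1[\uparrow].\cdots.1[\uparrow^{k_1-1}].s\circ\uparrow^{k_1}],\ldots,t_n[1.1[\uparrow].\cdots.1[\uparrow^{k_n-1}].s\circ\uparrow^{k_n}])$ where $f$ has binding arity $\langle k_1,\ldots,k_n\rangle$ and $s$ has sort $\langle q,p\rangle$. The congruence $\equiv$ on propositions is generated by rewriting subterms with $\sigma$. Sequent calculus modulo $\equiv$: the rules of LK where each rule may be applied to propositions congruent to the ones displayed (axiom $A\vdash B$ if $A\equiv B$; cut on $A$, $B$ with $A\equiv B$; e.g. $\wedge$-right concludes $\Gamma\vdash C,\Delta$ from $\Gamma\vdash A,\Delta$ and $\Gamma\vdash B,\Delta$ whenever $C\equiv A\wedge B$; $\exists$-right concludes $\Gamma\vdash B,\Delta$ from $\Gamma\vdash C,\Delta$ when $B\equiv\exists x A$ and $C\equiv(t/x)A$; similarly for all rules). -}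

module Defs where

open import Data.Nat using (ℕ; zero; suc; _+_)
open import Data.Nat.Properties using (+-suc; +-identityʳ)
open import Data.Fin using (Fin; zero; suc; splitAt; _↑ˡ_; _↑ʳ_; toℕ)
open import Data.List using (List; []; _∷_; map; replicate)
open import Data.Sum using (_⊎_; inj₁; inj₂; [_,_]′; map₁)
open import Data.List.Relation.Binary.Permutation.Propositional using (_↭_)
open import Relation.Binary.PropositionalEquality using (_≡_; refl; trans; cong; subst)
open import Relation.Binary.Construct.Closure.Equivalence using (EqClosure)

-- Languages of binding logic.
-- A function symbol f has binding arity ⟨k₁,…,kₙ⟩ = farity f,
-- a predicate symbol P has binding arity parity P.

record Lang : Set₁ where
  field
    FSym   : Set
    farity : FSym → List ℕ
    PSym   : Set
    parity : PSym → List ℕ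

-- Sorts of the target language L' :  tm n  is the sort n,
-- sb n p  is the sort ⟨n,p⟩.

data Sort : Set where
  tm : ℕ → Sort
  sb : ℕ → ℕ → Sort

-- addition by recursion on the first argument, tail-recursively
-- (j ⊕ m = j + m, see ⊕≡+ below); used to index ↑^j at sort ⟨j+m,m⟩
_⊕_ : ℕ → ℕ → ℕ
zero  ⊕ m = m
suc j ⊕ m = j ⊕ suc m

⊕≡+ : ∀ j m → j ⊕ m ≡ j + m
⊕≡+ zero    m = refl
⊕≡+ (suc j) m = trans (⊕≡+ j (suc m)) (+-suc j m)

⊕-zero : ∀ j → j ⊕ 0 ≡ j
⊕-zero j = trans (⊕≡+ j 0) (+-identityʳ j)

module _ (L : Lang) where
  open Lang L

  -- BINDING LOGIC (source), α-equivalence classes represented with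
  -- de Bruijn indices.  STm n : terms with n variables in scope.
  -- In f(x₁⋯x_k t, …), inside t the index 0 is x_k, …, index k-1 is x₁,
  -- and index k+i is the outer variable i.

  mutual
    data STm (n : ℕ) : Set where
      var : Fin n → STm n
      app : (f : FSym) → SArgs n (farity f) → STm n

    data SArgs (n : ℕ) : List ℕ → Set where
      []  : SArgs n []
      _∷_ : ∀ {k ks} → STm (k + n) → SArgs n ks → SArgs n (k ∷ ks)

  infixr 6 _⊃_
  infixr 7 _∧_ _∨_

  data SForm (n : ℕ) : Set where
    atom : (P : PSym) → SArgs n (parity P) → SForm n
    _⊃_ _∧_ _∨_ : SForm n → SForm n → SForm n
    ⊥ : SForm n
    ∀' ∃' : SForm (suc n) → SForm n

  liftR : ∀ {n m} k → (Fin n → Fin m) → Fin (k + n) → Fin (k + m)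
  liftR {n} {m} k ρ i = [ (λ j → j ↑ˡ m) , (λ j → k ↑ʳ ρ j) ]′ (splitAt k i)

  mutual
    renT : ∀ {n m} → (Fin n → Fin m) → STm n → STm m
    renT ρ (var i)    = var (ρ i)
    renT ρ (app f as) = app f (renA ρ as)

    renA : ∀ {n m ks} → (Fin n → Fin m) → SArgs n ks → SArgs m ks
    renA ρ [] = []
    renA ρ (_∷_ {k} t as) = renT (liftR k ρ) t ∷ renA ρ as

  liftS : ∀ {n m} k → (Fin n → STm m) → Fin (k + n) → STm (k + m)
  liftS {n} {m} k σ i =
    [ (λ j → var (j ↑ˡ m)) , (λ j → renT (k ↑ʳ_) (σ j)) ]′ (splitAt k i)

  mutual
    subT : ∀ {n m} → (Fin n → STm m) → STm n → STm m
    subT σ (var i)    = σ i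
    subT σ (app f as) = app f (subA σ as)

    subA : ∀ {n m ks} → (Fin n → STm m) → SArgs n ks → SArgs m ks
    subA σ [] = []
    subA σ (_∷_ {k} t as) = subT (liftS k σ) t ∷ subA σ as

  renF : ∀ {n m} → (Fin n → Fin m) → SForm n → SForm m
  renF ρ (atom P as) = atom P (renA ρ as)
  renF ρ (A ⊃ B) = renF ρ A ⊃ renF ρ B
  renF ρ (A ∧ B) = renF ρ A ∧ renF ρ B
  renF ρ (A ∨ B) = renF ρ A ∨ renF ρ B
  renF ρ ⊥ = ⊥
  renF ρ (∀' A) = ∀' (renF (liftR 1 ρ) A)
  renF ρ (∃' A) = ∃' (renF (liftR 1 ρ) A)

  subF : ∀ {n m} → (Fin n → STm m) → SForm n → SForm m
  subF σ (atom P as) = atom P (subA σ as)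
  subF σ (A ⊃ B) = subF σ A ⊃ subF σ B
  subF σ (A ∧ B) = subF σ A ∧ subF σ B
  subF σ (A ∨ B) = subF σ A ∨ subF σ B
  subF σ ⊥ = ⊥
  subF σ (∀' A) = ∀' (subF (liftS 1 σ) A)
  subF σ (∃' A) = ∃' (subF (liftS 1 σ) A)

  instS : ∀ {n} → SForm (suc n) → STm n → SForm n
  instS {n} A t = subF σ A
    where
    σ : Fin (suc n) → STm n
    σ zero    = t
    σ (suc i) = var i

  wkS : ∀ {n} → SForm n → SForm (suc n)
  wkS = renF suc

  -- Classical sequent calculus LK (multisets represented by lists up to
  -- permutation, rule exch).  LK n Γ Δ : derivations of Γ ⊢ Δ whose free
  -- variables are among n variables.  Rule fresh: an unused variable may
  -- be introduced (in LK with named variables, infinitely many variables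
  -- are always available).
  data LK : (n : ℕ) → List (SForm n) → List (SForm n) → Set where
    ax     : ∀ {n A} → LK n (A ∷ []) (A ∷ [])
    cut    : ∀ {n Γ Δ} A → LK n (A ∷ Γ) Δ → LK n Γ (A ∷ Δ) → LK n Γ Δ
    contrL : ∀ {n Γ Δ A} → LK n (A ∷ A ∷ Γ) Δ → LK n (A ∷ Γ) Δ
    contrR : ∀ {n Γ Δ A} → LK n Γ (A ∷ A ∷ Δ) → LK n Γ (A ∷ Δ)
    weakL  : ∀ {n Γ Δ A} → LK n Γ Δ → LK n (A ∷ Γ) Δ
    weakR  : ∀ {n Γ Δ A} → LK n Γ Δ → LK n Γ (A ∷ Δ)
    exch   : ∀ {n Γ Γ' Δ Δ'} → Γ ↭ Γ' → Δ ↭ Δ' → LK n Γ Δ → LK n Γ' Δ'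
    ⊃L     : ∀ {n Γ Δ A B} → LK n Γ (A ∷ Δ) → LK n (B ∷ Γ) Δ → LK n ((A ⊃ B) ∷ Γ) Δ
    ⊃R     : ∀ {n Γ Δ A B} → LK n (A ∷ Γ) (B ∷ Δ) → LK n Γ ((A ⊃ B) ∷ Δ)
    ∧L     : ∀ {n Γ Δ A B} → LK n (A ∷ B ∷ Γ) Δ → LK n ((A ∧ B) ∷ Γ) Δ
    ∧R     : ∀ {n Γ Δ A B} → LK n Γ (A ∷ Δ) → LK n Γ (B ∷ Δ) → LK n Γ ((A ∧ B) ∷ Δ)
    ∨L     : ∀ {n Γ Δ A B} → LK n (A ∷ Γ) Δ → LK n (B ∷ Γ) Δ → LK n ((A ∨ B) ∷ Γ) Δ
    ∨R     : ∀ {n Γ Δ A B} → LK n Γ (A ∷ B ∷ Δ) → LK n Γ ((A ∨ B) ∷ Δ)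
    ⊥L     : ∀ {n Γ Δ} → LK n (⊥ ∷ Γ) Δ
    ∀L     : ∀ {n Γ Δ A} (t : STm n) → LK n (instS A t ∷ Γ) Δ → LK n (∀' A ∷ Γ) Δ
    ∀R     : ∀ {n Γ Δ A} → LK (suc n) (map wkS Γ) (A ∷ map wkS Δ) → LK n Γ (∀' A ∷ Δ)
    ∃L     : ∀ {n Γ Δ A} → LK (suc n) (A ∷ map wkS Γ) (map wkS Δ) → LK n (∃' A ∷ Γ) Δ
    ∃R     : ∀ {n Γ Δ A} (t : STm n) → LK n Γ (instS A t ∷ Δ) → LK n Γ (∃' A ∷ Δ)
    fresh  : ∀ {n Γ Δ} → LK (suc n) (map wkS Γ) (map wkS Δ) → LK n Γ Δ

  data Var : List Sort → Sort → Set where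
    vz : ∀ {Ξ s} → Var (s ∷ Ξ) s
    vs : ∀ {Ξ s s'} → Var Ξ s → Var (s' ∷ Ξ) s

  -- sort of the argument of f_p bound by k variables : k + p
  tmPlus : ℕ → ℕ → Sort
  tmPlus p k = tm (k + p)

  infixl 8 _[_]
  infix 4 _↦_ _⟶_ _⟶s_ _⟶F_ _≡σ_
  infixr 6 _∙_
  infixl 7 _∘_

  mutual
    data Term (Ξ : List Sort) : Sort → Set where
      var  : ∀ {s} → Var Ξ s → Term Ξ s
      fn   : (f : FSym) (p : ℕ) → Terms Ξ (map (tmPlus p) (farity f)) → Term Ξ (tm p)
      -- cst i (i : Fin n) is the constant (toℕ i + 1)ₙ of sort n
      cst  : ∀ {n} → Fin n → Term Ξ (tm n)
      _[_] : ∀ {n p} → Term Ξ (tm p) → Term Ξ (sb n p) → Term Ξ (tm n)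
      idS  : ∀ {n} → Term Ξ (sb n n)
      _∙_  : ∀ {n p} → Term Ξ (tm n) → Term Ξ (sb n p) → Term Ξ (sb n (suc p))
      ↑    : ∀ {n} → Term Ξ (sb (suc n) n)
      _∘_  : ∀ {n p q} → Term Ξ (sb p n) → Term Ξ (sb q p) → Term Ξ (sb q n)

    data Terms (Ξ : List Sort) : List Sort → Set where
      []  : Terms Ξ []
      _∷_ : ∀ {s ss} → Term Ξ s → Terms Ξ ss → Terms Ξ (s ∷ ss)

  data Form (Ξ : List Sort) : Set where
    atom : (P : PSym) → Terms Ξ (map tm (parity P)) → Form Ξ
    _⊃_ _∧_ _∨_ : Form Ξ → Form Ξ → Form Ξ
    ⊥ : Form Ξ
    ∀' ∃' : (s : Sort) → Form (s ∷ Ξ) → Form Ξ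

  ⇑ : ∀ {Ξ} (j m : ℕ) → Term Ξ (sb (j ⊕ m) m)
  ⇑ zero          m = idS
  ⇑ (suc zero)    m = ↑
  ⇑ (suc (suc j)) m = ↑ {n = m} ∘ ⇑ (suc j) (suc m)

  ⇑₀ : ∀ {Ξ} (m : ℕ) → Term Ξ (sb m 0)
  ⇑₀ {Ξ} m = subst (λ N → Term Ξ (sb N 0)) (⊕-zero m) (⇑ m 0)

  oneUp : ∀ {Ξ} (j m : ℕ) → Term Ξ (tm (j ⊕ suc m))
  oneUp zero    m = cst zero
  oneUp (suc j) m = (cst zero) [ ⇑ (suc j) (suc m) ]

  chain : ∀ {Ξ q p} → Term Ξ (sb q p) → (j r : ℕ) → Term Ξ (sb (j ⊕ (r + q)) (r + p))
  chain {q = q} s j zero    = s ∘ ⇑ j q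
  chain {q = q} s j (suc r) = oneUp j (r + q) ∙ chain s (suc j) r

  pushArgs : ∀ {Ξ q p} → Term Ξ (sb q p) → (ks : List ℕ)
           → Terms Ξ (map (tmPlus p) ks) → Terms Ξ (map (tmPlus q) ks)
  pushArgs s [] [] = []
  pushArgs s (k ∷ ks) (t ∷ ts) = t [ chain s 0 k ] ∷ pushArgs s ks ts

  data _↦_ {Ξ : List Sort} : ∀ {s} → Term Ξ s → Term Ξ s → Set where
    r-num    : ∀ {n p} (i : Fin (suc n ⊕ suc p)) → toℕ i ≡ suc n
             → cst i ↦ (cst zero) [ ⇑ (suc n) (suc p) ]
    r-one    : ∀ {n p} {t : Term Ξ (tm n)} {s : Term Ξ (sb n p)}
             → (cst zero) [ t ∙ s ] ↦ t
    r-id     : ∀ {n} {t : Term Ξ (tm n)} → t [ idS ] ↦ t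
    r-clos   : ∀ {m n p} {t : Term Ξ (tm p)} {s : Term Ξ (sb n p)} {s' : Term Ξ (sb m n)}
             → (t [ s ]) [ s' ] ↦ t [ s ∘ s' ]
    r-idl    : ∀ {n q} {s : Term Ξ (sb q n)} → idS ∘ s ↦ s
    r-shcons : ∀ {n q} {t : Term Ξ (tm q)} {s : Term Ξ (sb q n)} → ↑ ∘ (t ∙ s) ↦ s
    r-assoc  : ∀ {n p q r} {s₁ : Term Ξ (sb p n)} {s₂ : Term Ξ (sb q p)} {s₃ : Term Ξ (sb r q)}
             → (s₁ ∘ s₂) ∘ s₃ ↦ s₁ ∘ (s₂ ∘ s₃)
    r-map    : ∀ {n p q} {t : Term Ξ (tm n)} {s : Term Ξ (sb n p)} {s' : Term Ξ (sb q n)}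
             → (t ∙ s) ∘ s' ↦ (t [ s' ]) ∙ (s ∘ s')
    r-idr    : ∀ {n q} {s : Term Ξ (sb q n)} → s ∘ idS ↦ s
    r-vid    : ∀ {q} → cst zero ∙ ↑ {n = q} ↦ idS
    r-scons  : ∀ {n p} {s : Term Ξ (sb n (suc p))} → ((cst zero) [ s ]) ∙ (↑ ∘ s) ↦ s
    r-fn     : ∀ {p q} (f : FSym) (ts : Terms Ξ (map (tmPlus p) (farity f))) (s : Term Ξ (sb q p))
             → (fn f p ts) [ s ] ↦ fn f q (pushArgs s (farity f) ts)

  mutual
    data _⟶_ {Ξ : List Sort} : ∀ {s} → Term Ξ s → Term Ξ s → Set where
      root  : ∀ {s} {t u : Term Ξ s} → t ↦ u → t ⟶ u
      fn-c  : ∀ {f p ts us} → ts ⟶s us → (fn f p ts) ⟶ (fn f p us)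
      clos₁ : ∀ {n p} {t t' : Term Ξ (tm p)} {s : Term Ξ (sb n p)} → t ⟶ t' → t [ s ] ⟶ t' [ s ]
      clos₂ : ∀ {n p} {t : Term Ξ (tm p)} {s s' : Term Ξ (sb n p)} → s ⟶ s' → t [ s ] ⟶ t [ s' ]
      cons₁ : ∀ {n p} {t t' : Term Ξ (tm n)} {s : Term Ξ (sb n p)} → t ⟶ t' → t ∙ s ⟶ t' ∙ s
      cons₂ : ∀ {n p} {t : Term Ξ (tm n)} {s s' : Term Ξ (sb n p)} → s ⟶ s' → t ∙ s ⟶ t ∙ s'
      comp₁ : ∀ {n p q} {s s' : Term Ξ (sb p n)} {u : Term Ξ (sb q p)} → s ⟶ s' → s ∘ u ⟶ s' ∘ u
      comp₂ : ∀ {n p q} {s : Term Ξ (sb p n)} {u u' : Term Ξ (sb q p)} → u ⟶ u' → s ∘ u ⟶ s ∘ u'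

    data _⟶s_ {Ξ : List Sort} : ∀ {ss} → Terms Ξ ss → Terms Ξ ss → Set where
      hd : ∀ {s ss} {t u : Term Ξ s} {ts : Terms Ξ ss} → t ⟶ u → (t ∷ ts) ⟶s (u ∷ ts)
      tl : ∀ {s ss} {t : Term Ξ s} {ts us : Terms Ξ ss} → ts ⟶s us → (t ∷ ts) ⟶s (t ∷ us)

  data _⟶F_ : ∀ {Ξ} → Form Ξ → Form Ξ → Set where
    atom-c : ∀ {Ξ P} {ts us : Terms Ξ (map tm (parity P))} → ts ⟶s us → atom P ts ⟶F atom P us
    ⊃₁ : ∀ {Ξ} {A A' B : Form Ξ} → A ⟶F A' → (A ⊃ B) ⟶F (A' ⊃ B)
    ⊃₂ : ∀ {Ξ} {A B B' : Form Ξ} → B ⟶F B' → (A ⊃ B) ⟶F (A ⊃ B')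
    ∧₁ : ∀ {Ξ} {A A' B : Form Ξ} → A ⟶F A' → (A ∧ B) ⟶F (A' ∧ B)
    ∧₂ : ∀ {Ξ} {A B B' : Form Ξ} → B ⟶F B' → (A ∧ B) ⟶F (A ∧ B')
    ∨₁ : ∀ {Ξ} {A A' B : Form Ξ} → A ⟶F A' → (A ∨ B) ⟶F (A' ∨ B)
    ∨₂ : ∀ {Ξ} {A B B' : Form Ξ} → B ⟶F B' → (A ∨ B) ⟶F (A ∨ B')
    ∀-c : ∀ {Ξ s} {A A' : Form (s ∷ Ξ)} → A ⟶F A' → ∀' s A ⟶F ∀' s A'
    ∃-c : ∀ {Ξ s} {A A' : Form (s ∷ Ξ)} → A ⟶F A' → ∃' s A ⟶F ∃' s A'

  _≡σ_ : ∀ {Ξ} → Form Ξ → Form Ξ → Set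
  _≡σ_ {Ξ} = EqClosure (_⟶F_ {Ξ})

  mutual
    renT' : ∀ {Ξ Θ s} → (∀ {s'} → Var Ξ s' → Var Θ s') → Term Ξ s → Term Θ s
    renT' ρ (var x) = var (ρ x)
    renT' ρ (fn f p ts) = fn f p (renTs' ρ ts)
    renT' ρ (cst i) = cst i
    renT' ρ (t [ s ]) = renT' ρ t [ renT' ρ s ]
    renT' ρ idS = idS
    renT' ρ (t ∙ s) = renT' ρ t ∙ renT' ρ s
    renT' ρ ↑ = ↑
    renT' ρ (s ∘ u) = renT' ρ s ∘ renT' ρ u

    renTs' : ∀ {Ξ Θ ss} → (∀ {s'} → Var Ξ s' → Var Θ s') → Terms Ξ ss → Terms Θ ss
    renTs' ρ [] = []
    renTs' ρ (t ∷ ts) = renT' ρ t ∷ renTs' ρ ts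

  mutual
    subT' : ∀ {Ξ Θ s} → (∀ {s'} → Var Ξ s' → Term Θ s') → Term Ξ s → Term Θ s
    subT' σ (var x) = σ x
    subT' σ (fn f p ts) = fn f p (subTs' σ ts)
    subT' σ (cst i) = cst i
    subT' σ (t [ s ]) = subT' σ t [ subT' σ s ]
    subT' σ idS = idS
    subT' σ (t ∙ s) = subT' σ t ∙ subT' σ s
    subT' σ ↑ = ↑
    subT' σ (s ∘ u) = subT' σ s ∘ subT' σ u

    subTs' : ∀ {Ξ Θ ss} → (∀ {s'} → Var Ξ s' → Term Θ s') → Terms Ξ ss → Terms Θ ss
    subTs' σ [] = []
    subTs' σ (t ∷ ts) = subT' σ t ∷ subTs' σ ts

  liftV : ∀ {Ξ Θ s} → (∀ {s'} → Var Ξ s' → Var Θ s') → ∀ {s'} → Var (s ∷ Ξ) s' → Var (s ∷ Θ) s'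
  liftV ρ vz = vz
  liftV ρ (vs x) = vs (ρ x)

  liftσ : ∀ {Ξ Θ s} → (∀ {s'} → Var Ξ s' → Term Θ s') → ∀ {s'} → Var (s ∷ Ξ) s' → Term (s ∷ Θ) s'
  liftσ σ vz = var vz
  liftσ σ (vs x) = renT' vs (σ x)

  renF' : ∀ {Ξ Θ} → (∀ {s'} → Var Ξ s' → Var Θ s') → Form Ξ → Form Θ
  renF' ρ (atom P ts) = atom P (renTs' ρ ts)
  renF' ρ (A ⊃ B) = renF' ρ A ⊃ renF' ρ B
  renF' ρ (A ∧ B) = renF' ρ A ∧ renF' ρ B
  renF' ρ (A ∨ B) = renF' ρ A ∨ renF' ρ B
  renF' ρ ⊥ = ⊥
  renF' ρ (∀' s A) = ∀' s (renF' (liftV ρ) A)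
  renF' ρ (∃' s A) = ∃' s (renF' (liftV ρ) A)

  subF' : ∀ {Ξ Θ} → (∀ {s'} → Var Ξ s' → Term Θ s') → Form Ξ → Form Θ
  subF' σ (atom P ts) = atom P (subTs' σ ts)
  subF' σ (A ⊃ B) = subF' σ A ⊃ subF' σ B
  subF' σ (A ∧ B) = subF' σ A ∧ subF' σ B
  subF' σ (A ∨ B) = subF' σ A ∨ subF' σ B
  subF' σ ⊥ = ⊥
  subF' σ (∀' s A) = ∀' s (subF' (liftσ σ) A)
  subF' σ (∃' s A) = ∃' s (subF' (liftσ σ) A)

  instT : ∀ {Ξ s} → Form (s ∷ Ξ) → Term Ξ s → Form Ξ
  instT {Ξ} {s} A t = subF' σ A
    where
    σ : ∀ {s'} → Var (s ∷ Ξ) s' → Term Ξ s'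
    σ vz = t
    σ (vs x) = var x

  wkT : ∀ {Ξ s} → Form Ξ → Form (s ∷ Ξ)
  wkT = renF' vs

  data LKσ : (Ξ : List Sort) → List (Form Ξ) → List (Form Ξ) → Set where
    ax     : ∀ {Ξ} {A B : Form Ξ} → A ≡σ B → LKσ Ξ (A ∷ []) (B ∷ [])
    cut    : ∀ {Ξ Γ Δ} {A B : Form Ξ} → A ≡σ B → LKσ Ξ (A ∷ Γ) Δ → LKσ Ξ Γ (B ∷ Δ) → LKσ Ξ Γ Δ
    contrL : ∀ {Ξ Γ Δ} {A B C : Form Ξ} → A ≡σ B → A ≡σ C
           → LKσ Ξ (B ∷ C ∷ Γ) Δ → LKσ Ξ (A ∷ Γ) Δ
    contrR : ∀ {Ξ Γ Δ} {A B C : Form Ξ} → A ≡σ B → A ≡σ C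
           → LKσ Ξ Γ (B ∷ C ∷ Δ) → LKσ Ξ Γ (A ∷ Δ)
    weakL  : ∀ {Ξ Γ Δ} {A : Form Ξ} → LKσ Ξ Γ Δ → LKσ Ξ (A ∷ Γ) Δ
    weakR  : ∀ {Ξ Γ Δ} {A : Form Ξ} → LKσ Ξ Γ Δ → LKσ Ξ Γ (A ∷ Δ)
    exch   : ∀ {Ξ Γ Γ' Δ Δ'} → Γ ↭ Γ' → Δ ↭ Δ' → LKσ Ξ Γ Δ → LKσ Ξ Γ' Δ'
    ⊃L     : ∀ {Ξ Γ Δ} {A B C : Form Ξ} → C ≡σ (A ⊃ B)
           → LKσ Ξ Γ (A ∷ Δ) → LKσ Ξ (B ∷ Γ) Δ → LKσ Ξ (C ∷ Γ) Δ
    ⊃R     : ∀ {Ξ Γ Δ} {A B C : Form Ξ} → C ≡σ (A ⊃ B)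
           → LKσ Ξ (A ∷ Γ) (B ∷ Δ) → LKσ Ξ Γ (C ∷ Δ)
    ∧L     : ∀ {Ξ Γ Δ} {A B C : Form Ξ} → C ≡σ (A ∧ B)
           → LKσ Ξ (A ∷ B ∷ Γ) Δ → LKσ Ξ (C ∷ Γ) Δ
    ∧R     : ∀ {Ξ Γ Δ} {A B C : Form Ξ} → C ≡σ (A ∧ B)
           → LKσ Ξ Γ (A ∷ Δ) → LKσ Ξ Γ (B ∷ Δ) → LKσ Ξ Γ (C ∷ Δ)
    ∨L     : ∀ {Ξ Γ Δ} {A B C : Form Ξ} → C ≡σ (A ∨ B)
           → LKσ Ξ (A ∷ Γ) Δ → LKσ Ξ (B ∷ Γ) Δ → LKσ Ξ (C ∷ Γ) Δ
    ∨R     : ∀ {Ξ Γ Δ} {A B C : Form Ξ} → C ≡σ (A ∨ B)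
           → LKσ Ξ Γ (A ∷ B ∷ Δ) → LKσ Ξ Γ (C ∷ Δ)
    ⊥L     : ∀ {Ξ Γ Δ} {A : Form Ξ} → A ≡σ ⊥ → LKσ Ξ (A ∷ Γ) Δ
    ∀L     : ∀ {Ξ Γ Δ s} {A : Form (s ∷ Ξ)} {B C : Form Ξ} (t : Term Ξ s)
           → B ≡σ ∀' s A → C ≡σ instT A t → LKσ Ξ (C ∷ Γ) Δ → LKσ Ξ (B ∷ Γ) Δ
    ∀R     : ∀ {Ξ Γ Δ s} {A : Form (s ∷ Ξ)} {B : Form Ξ} → B ≡σ ∀' s A
           → LKσ (s ∷ Ξ) (map wkT Γ) (A ∷ map wkT Δ) → LKσ Ξ Γ (B ∷ Δ)
    ∃L     : ∀ {Ξ Γ Δ s} {A : Form (s ∷ Ξ)} {B : Form Ξ} → B ≡σ ∃' s A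
           → LKσ (s ∷ Ξ) (A ∷ map wkT Γ) (map wkT Δ) → LKσ Ξ (B ∷ Γ) Δ
    ∃R     : ∀ {Ξ Γ Δ s} {A : Form (s ∷ Ξ)} {B C : Form Ξ} (t : Term Ξ s)
           → B ≡σ ∃' s A → C ≡σ instT A t → LKσ Ξ Γ (C ∷ Δ) → LKσ Ξ Γ (B ∷ Δ)
    fresh  : ∀ {Ξ Γ Δ} (s : Sort) → LKσ (s ∷ Ξ) (map wkT Γ) (map wkT Δ) → LKσ Ξ Γ Δ

  -- PRE-COOKING F(·,l).  The list l of term-bound variables is encoded
  -- by a classifier ρ sending each de Bruijn variable either to its
  -- (first, 0-based) position in l (a Fin |l|) or to the L'-variable of
  -- sort 0 it stands for.

  toVar : ∀ {n} → Fin n → Var (replicate n (tm 0)) (tm 0)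
  toVar zero    = vz
  toVar (suc i) = vs (toVar i)

  -- l ↦ x_k ⋯ x₁ . l
  extCls : ∀ {Ξ c m} k → (Fin c → Fin m ⊎ Var Ξ (tm 0)) → Fin (k + c) → Fin (k + m) ⊎ Var Ξ (tm 0)
  extCls {m = m} k ρ i = [ (λ j → inj₁ (j ↑ˡ m)) , (λ j → map₁ (k ↑ʳ_) (ρ j)) ]′ (splitAt k i)

  -- ε ↦ x_k ⋯ x₁
  predCls : ∀ {Ξ c} k → (Fin c → Var Ξ (tm 0)) → Fin (k + c) → Fin k ⊎ Var Ξ (tm 0)
  predCls k ρ i = [ inj₁ , (λ j → inj₂ (ρ j)) ]′ (splitAt k i)

  mutual
    FT : ∀ {Ξ c} (m : ℕ) → (Fin c → Fin m ⊎ Var Ξ (tm 0)) → STm c → Term Ξ (tm m)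
    FT m ρ (var i)    = [ cst , (λ x → (var x) [ ⇑₀ m ]) ]′ (ρ i)
    FT m ρ (app f as) = fn f m (FA m ρ as)

    FA : ∀ {Ξ c ks} (m : ℕ) → (Fin c → Fin m ⊎ Var Ξ (tm 0)) → SArgs c ks → Terms Ξ (map (tmPlus m) ks)
    FA m ρ [] = []
    FA m ρ (_∷_ {k} t as) = FT (k + m) (extCls k ρ) t ∷ FA m ρ as

  FPA : ∀ {Ξ c ks} → (Fin c → Var Ξ (tm 0)) → SArgs c ks → Terms Ξ (map tm ks)
  FPA ρ [] = []
  FPA ρ (_∷_ {k} t as) = FT k (predCls k ρ) t ∷ FPA ρ as

  pre : ∀ {n} → SForm n → Form (replicate n (tm 0))
  pre (atom P as) = atom P (FPA toVar as)
  pre (A ⊃ B) = pre A ⊃ pre B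
  pre (A ∧ B) = pre A ∧ pre B
  pre (A ∨ B) = pre A ∨ pre B
  pre ⊥ = ⊥
  pre (∀' A) = ∀' (tm 0) (pre A)
  pre (∃' A) = ∃' (tm 0) (pre A)

{-# OPTIONS --safe #-}
-- From LK modulo σ back to LK, σ-terms are evaluated in binding logic: a term of
-- sort n is a source term with n extra variables, a term of sort ⟨n,p⟩ is a
-- simultaneous substitution, and every rule of σ becomes an identity between
-- substitutions. Propositions of L' are then forced at sequents of LK, with
-- "the current sequent is provable" in place of falsity. Since LK has the cut
-- rule, a pre-cooked proposition A' is forced at Γ ⊢ Δ exactly when A[η] is
-- provable on the right of all extensions of Γ ⊢ Δ, and soundness of LK modulo σ
-- for forcing gives the result without cut elimination or confluence of σ.
--
-- From LK to LK modulo σ, the point is that pre-cooking commutes with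
-- substitution up to σ: ↑^k, and every chain pushed under a binder, acts on
-- pre-cooked terms as a renaming of the constants 1,…,n.
module Submission where

open import Defs
open import Data.Nat using (ℕ; zero; suc; _+_)
open import Data.Nat.Properties using (+-assoc; +-suc; +-identityʳ)
open import Data.Fin using (Fin; zero; suc; splitAt; _↑ˡ_; _↑ʳ_; toℕ; cast)
open import Data.Fin.Properties
  using (splitAt-↑ˡ; splitAt-↑ʳ; splitAt⁻¹-↑ˡ; splitAt⁻¹-↑ʳ; toℕ-injective; toℕ-↑ˡ; toℕ-↑ʳ; toℕ-cast)
open import Data.Sum using (_⊎_; inj₁; inj₂; [_,_]′; map₁; map₂)
open import Data.Product using (_×_; _,_; proj₁; proj₂; ∃-syntax; Σ-syntax)
open import Data.List using (List; []; _∷_; map; replicate)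
open import Data.List.Properties using (map-∘; map-cong)
open import Data.List.Relation.Unary.All using (All; []; _∷_) renaming (map to mapAll)
import Data.List.Relation.Unary.All as All
import Data.List.Relation.Unary.All.Properties as All
open import Data.List.Relation.Unary.Any using (here; there)
open import Data.List.Membership.Propositional using (_∈_)
open import Data.List.Membership.Propositional.Properties using (∈-∃++; ∈-map⁺)
open import Data.List.Relation.Binary.Permutation.Propositional using (_↭_; ↭-refl; ↭-sym; prep; swap)
open import Data.List.Relation.Binary.Permutation.Propositional.Properties using (shift; All-resp-↭; map⁺)
open import Data.Vec using (Vec; []; _∷_; lookup; tabulate) renaming (map to mapV)
open import Data.Vec.Properties using (tabulate-∘; tabulate-cong; tabulate∘lookup; lookup∘tabulate; lookup-map)
  renaming (map-cong to mapV-cong; map-id to mapV-id; map-∘ to mapV-∘)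
open import Function.Bundles using (_⇔_; mk⇔)
open import Relation.Binary.PropositionalEquality
  using (_≡_; refl; sym; trans; cong; cong₂; subst; subst₂)
open import Relation.Binary.Construct.Closure.ReflexiveTransitive using (ε; _◅_; _◅◅_)
open import Relation.Binary.Construct.Closure.Symmetric using (fwd; bwd)
open import Relation.Binary.Construct.Closure.Equivalence using (EqClosure; gmap; symmetric; return)

-- A rule-by-rule translation back to LK is blocked by derivations that pass through propositions
-- outside the image of pre-cooking: a cut may quantify over a sort n > 0 or over substitutions, and
-- binding logic has no such quantifier. Forcing reads these quantifiers in the metalanguage, over
-- all values in all extensions of the current sequent. Only the end sequent has to be pre-cooked
-- for its forcing to be compared with provability.
--
-- Eigenvariables make the set of free source variables grow during this argument. Hence every value
-- lives over a number m of ambient variables, and extensions rename them; most of the work on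
-- evaluation is to show that it respects such renamings and that the chain in the rule for f is the
-- usual lifting of a substitution under binders.
--
-- In the other direction the obstacle is again that chain: once a shift meets a function symbol it
-- is no longer a shift, so the induction must cover a class of substitutions that contains the
-- shifts and is closed under forming chains.

module _ {A : Set} {k n : ℕ} {f : Fin k → A} {g : Fin n → A} where

  copair-↑ˡ : ∀ j → [ f , g ]′ (splitAt k (j ↑ˡ n)) ≡ f j
  copair-↑ˡ j = cong [ f , g ]′ (splitAt-↑ˡ k j n)

  copair-↑ʳ : ∀ j → [ f , g ]′ (splitAt k (k ↑ʳ j)) ≡ g j
  copair-↑ʳ j = cong [ f , g ]′ (splitAt-↑ʳ k n j)

data Split k {n} : Fin (k + n) → Set where
  left  : (j : Fin k) → Split k (j ↑ˡ n)
  right : (j : Fin n) → Split k (k ↑ʳ j)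

split : ∀ k {n} (i : Fin (k + n)) → Split k i
split k {n} i with splitAt k i in eq
... | inj₁ j = subst (Split k) (splitAt⁻¹-↑ˡ eq) (left j)
... | inj₂ j = subst (Split k) (splitAt⁻¹-↑ʳ eq) (right j)

≗-split : ∀ {A : Set} k {n} {f g : Fin (k + n) → A}
        → (∀ j → f (j ↑ˡ n) ≡ g (j ↑ˡ n)) → (∀ j → f (k ↑ʳ j) ≡ g (k ↑ʳ j))
        → ∀ i → f i ≡ g i
≗-split k l r i with split k i
... | left j  = l j
... | right j = r j

∈⇒↭ : ∀ {X : Set} {x : X} {xs} → x ∈ xs → Σ[ ys ∈ List X ] xs ↭ x ∷ ys
∈⇒↭ {x = x} i with ∈-∃++ i
... | ys , zs , refl = _ , shift x ys zs

module _ (L : Lang) where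

  private variable
    m m' n n' p p' q q' k c c' : ℕ
    s s' : Sort
    ss Ξ Θ : List Sort

  -- Renaming and substitution in binding logic

  liftR-↑ˡ : ∀ k {ρ : Fin n → Fin m} (j : Fin k) → liftR L k ρ (j ↑ˡ n) ≡ j ↑ˡ m
  liftR-↑ˡ k = copair-↑ˡ

  liftR-↑ʳ : ∀ k {ρ : Fin n → Fin m} j → liftR L k ρ (k ↑ʳ j) ≡ k ↑ʳ ρ j
  liftR-↑ʳ k = copair-↑ʳ {k = k}

  liftS-↑ˡ : ∀ k {σ : Fin n → STm L m} (j : Fin k) → liftS L k σ (j ↑ˡ n) ≡ var (j ↑ˡ m)
  liftS-↑ˡ k = copair-↑ˡ

  liftS-↑ʳ : ∀ k {σ : Fin n → STm L m} j → liftS L k σ (k ↑ʳ j) ≡ renT L (k ↑ʳ_) (σ j)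
  liftS-↑ʳ k = copair-↑ʳ {k = k}

  liftR-id : ∀ k {ρ : Fin n → Fin n} → (∀ i → ρ i ≡ i) → ∀ i → liftR L k ρ i ≡ i
  liftR-id k h = ≗-split k (λ j → liftR-↑ˡ k j)
    (λ j → trans (liftR-↑ʳ k j) (cong (k ↑ʳ_) (h j)))

  mutual
    renT-id : {ρ : Fin n → Fin n} → (∀ i → ρ i ≡ i) → ∀ t → renT L ρ t ≡ t
    renT-id h (var i)    = cong var (h i)
    renT-id h (app f as) = cong (app f) (renA-id h as)

    renA-id : {ρ : Fin n → Fin n} → (∀ i → ρ i ≡ i) → ∀ {ks} (as : SArgs L n ks) → renA L ρ as ≡ as
    renA-id h [] = refl
    renA-id h (_∷_ {k} t as) = cong₂ _∷_ (renT-id (liftR-id k h) t) (renA-id h as)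

  renF-id : {ρ : Fin n → Fin n} → (∀ i → ρ i ≡ i) → ∀ A → renF L ρ A ≡ A
  renF-id h (atom P as) = cong (atom P) (renA-id h as)
  renF-id h (A ⊃ B) = cong₂ _⊃_ (renF-id h A) (renF-id h B)
  renF-id h (A ∧ B) = cong₂ _∧_ (renF-id h A) (renF-id h B)
  renF-id h (A ∨ B) = cong₂ _∨_ (renF-id h A) (renF-id h B)
  renF-id h ⊥ = refl
  renF-id h (∀' A) = cong ∀' (renF-id (liftR-id 1 h) A)
  renF-id h (∃' A) = cong ∃' (renF-id (liftR-id 1 h) A)

  -- The composite is a parameter `ρ''` specified pointwise: under a binder the lifted maps again
  -- satisfy such a specification, so the induction on terms goes through. The later composition
  -- laws have the same form.
  liftR-liftR : ∀ k {ρ : Fin n → Fin m} {ρ' : Fin m → Fin p} {ρ'' : Fin n → Fin p}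
              → (∀ i → ρ' (ρ i) ≡ ρ'' i) → ∀ i → liftR L k ρ' (liftR L k ρ i) ≡ liftR L k ρ'' i
  liftR-liftR k {ρ} {ρ'} {ρ''} h = ≗-split k
    (λ j → trans (cong (liftR L k ρ') (liftR-↑ˡ k j)) (trans (liftR-↑ˡ k j) (sym (liftR-↑ˡ k j))))
    (λ j → trans (cong (liftR L k ρ') (liftR-↑ʳ k j)) (trans (liftR-↑ʳ k (ρ j))
             (trans (cong (k ↑ʳ_) (h j)) (sym (liftR-↑ʳ k j)))))

  mutual
    renT-renT : {ρ : Fin n → Fin m} {ρ' : Fin m → Fin p} {ρ'' : Fin n → Fin p}
              → (∀ i → ρ' (ρ i) ≡ ρ'' i) → ∀ t → renT L ρ' (renT L ρ t) ≡ renT L ρ'' t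
    renT-renT h (var i)    = cong var (h i)
    renT-renT h (app f as) = cong (app f) (renA-renA h as)

    renA-renA : {ρ : Fin n → Fin m} {ρ' : Fin m → Fin p} {ρ'' : Fin n → Fin p}
              → (∀ i → ρ' (ρ i) ≡ ρ'' i) → ∀ {ks} (as : SArgs L n ks) → renA L ρ' (renA L ρ as) ≡ renA L ρ'' as
    renA-renA h [] = refl
    renA-renA h (_∷_ {k} t as) = cong₂ _∷_ (renT-renT (liftR-liftR k h) t) (renA-renA h as)

  renF-renF : {ρ : Fin n → Fin m} {ρ' : Fin m → Fin p} {ρ'' : Fin n → Fin p}
            → (∀ i → ρ' (ρ i) ≡ ρ'' i) → ∀ A → renF L ρ' (renF L ρ A) ≡ renF L ρ'' A
  renF-renF h (atom P as) = cong (atom P) (renA-renA h as)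
  renF-renF h (A ⊃ B) = cong₂ _⊃_ (renF-renF h A) (renF-renF h B)
  renF-renF h (A ∧ B) = cong₂ _∧_ (renF-renF h A) (renF-renF h B)
  renF-renF h (A ∨ B) = cong₂ _∨_ (renF-renF h A) (renF-renF h B)
  renF-renF h ⊥ = refl
  renF-renF h (∀' A) = cong ∀' (renF-renF (liftR-liftR 1 h) A)
  renF-renF h (∃' A) = cong ∃' (renF-renF (liftR-liftR 1 h) A)

  liftS-cong : ∀ k {σ τ : Fin n → STm L m} → (∀ i → σ i ≡ τ i) → ∀ i → liftS L k σ i ≡ liftS L k τ i
  liftS-cong k h = ≗-split k (λ j → trans (liftS-↑ˡ k j) (sym (liftS-↑ˡ k j)))
    (λ j → trans (liftS-↑ʳ k j) (trans (cong (renT L (k ↑ʳ_)) (h j)) (sym (liftS-↑ʳ k j))))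

  mutual
    subT-cong : {σ τ : Fin n → STm L m} → (∀ i → σ i ≡ τ i) → ∀ t → subT L σ t ≡ subT L τ t
    subT-cong h (var i)    = h i
    subT-cong h (app f as) = cong (app f) (subA-cong h as)

    subA-cong : {σ τ : Fin n → STm L m} → (∀ i → σ i ≡ τ i)
              → ∀ {ks} (as : SArgs L n ks) → subA L σ as ≡ subA L τ as
    subA-cong h [] = refl
    subA-cong h (_∷_ {k} t as) = cong₂ _∷_ (subT-cong (liftS-cong k h) t) (subA-cong h as)

  subF-cong : {σ τ : Fin n → STm L m} → (∀ i → σ i ≡ τ i) → ∀ A → subF L σ A ≡ subF L τ A
  subF-cong h (atom P as) = cong (atom P) (subA-cong h as)
  subF-cong h (A ⊃ B) = cong₂ _⊃_ (subF-cong h A) (subF-cong h B)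
  subF-cong h (A ∧ B) = cong₂ _∧_ (subF-cong h A) (subF-cong h B)
  subF-cong h (A ∨ B) = cong₂ _∨_ (subF-cong h A) (subF-cong h B)
  subF-cong h ⊥ = refl
  subF-cong h (∀' A) = cong ∀' (subF-cong (liftS-cong 1 h) A)
  subF-cong h (∃' A) = cong ∃' (subF-cong (liftS-cong 1 h) A)

  liftS-var : ∀ k {σ : Fin n → STm L m} {ρ : Fin n → Fin m} → (∀ i → σ i ≡ var (ρ i))
            → ∀ i → liftS L k σ i ≡ var (liftR L k ρ i)
  liftS-var k h = ≗-split k (λ j → trans (liftS-↑ˡ k j) (cong var (sym (liftR-↑ˡ k j))))
    (λ j → trans (liftS-↑ʳ k j) (trans (cong (renT L (k ↑ʳ_)) (h j)) (cong var (sym (liftR-↑ʳ k j)))))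

  mutual
    subT-var : {σ : Fin n → STm L m} {ρ : Fin n → Fin m} → (∀ i → σ i ≡ var (ρ i))
             → ∀ t → subT L σ t ≡ renT L ρ t
    subT-var h (var i)    = h i
    subT-var h (app f as) = cong (app f) (subA-var h as)

    subA-var : {σ : Fin n → STm L m} {ρ : Fin n → Fin m} → (∀ i → σ i ≡ var (ρ i))
             → ∀ {ks} (as : SArgs L n ks) → subA L σ as ≡ renA L ρ as
    subA-var h [] = refl
    subA-var h (_∷_ {k} t as) = cong₂ _∷_ (subT-var (liftS-var k h) t) (subA-var h as)

  subF-var : {σ : Fin n → STm L m} {ρ : Fin n → Fin m} → (∀ i → σ i ≡ var (ρ i))
           → ∀ A → subF L σ A ≡ renF L ρ A
  subF-var h (atom P as) = cong (atom P) (subA-var h as)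
  subF-var h (A ⊃ B) = cong₂ _⊃_ (subF-var h A) (subF-var h B)
  subF-var h (A ∧ B) = cong₂ _∧_ (subF-var h A) (subF-var h B)
  subF-var h (A ∨ B) = cong₂ _∨_ (subF-var h A) (subF-var h B)
  subF-var h ⊥ = refl
  subF-var h (∀' A) = cong ∀' (subF-var (liftS-var 1 h) A)
  subF-var h (∃' A) = cong ∃' (subF-var (liftS-var 1 h) A)

  subT-id : {σ : Fin n → STm L n} → (∀ i → σ i ≡ var i) → ∀ t → subT L σ t ≡ t
  subT-id h t = trans (subT-var h t) (renT-id (λ _ → refl) t)

  liftS-liftR : ∀ k {ρ : Fin n → Fin m} {σ : Fin m → STm L p} {τ : Fin n → STm L p}
              → (∀ i → σ (ρ i) ≡ τ i) → ∀ i → liftS L k σ (liftR L k ρ i) ≡ liftS L k τ i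
  liftS-liftR k {ρ} {σ} {τ} h = ≗-split k
    (λ j → trans (cong (liftS L k σ) (liftR-↑ˡ k j)) (trans (liftS-↑ˡ k j) (sym (liftS-↑ˡ k j))))
    (λ j → trans (cong (liftS L k σ) (liftR-↑ʳ k j)) (trans (liftS-↑ʳ k (ρ j))
             (trans (cong (renT L (k ↑ʳ_)) (h j)) (sym (liftS-↑ʳ k j)))))

  mutual
    subT-renT : {ρ : Fin n → Fin m} {σ : Fin m → STm L p} {τ : Fin n → STm L p}
              → (∀ i → σ (ρ i) ≡ τ i) → ∀ t → subT L σ (renT L ρ t) ≡ subT L τ t
    subT-renT h (var i)    = h i
    subT-renT h (app f as) = cong (app f) (subA-renA h as)

    subA-renA : {ρ : Fin n → Fin m} {σ : Fin m → STm L p} {τ : Fin n → STm L p}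
              → (∀ i → σ (ρ i) ≡ τ i) → ∀ {ks} (as : SArgs L n ks) → subA L σ (renA L ρ as) ≡ subA L τ as
    subA-renA h [] = refl
    subA-renA h (_∷_ {k} t as) = cong₂ _∷_ (subT-renT (liftS-liftR k h) t) (subA-renA h as)

  renT-↑ʳ : ∀ k (ρ : Fin n → Fin m) t → renT L (liftR L k ρ) (renT L (k ↑ʳ_) t) ≡ renT L (k ↑ʳ_) (renT L ρ t)
  renT-↑ʳ k ρ t = trans (renT-renT (λ i → liftR-↑ʳ k i) t) (sym (renT-renT (λ _ → refl) t))

  liftR-liftS : ∀ k {σ : Fin n → STm L m} {ρ : Fin m → Fin p} {τ : Fin n → STm L p}
              → (∀ i → renT L ρ (σ i) ≡ τ i) → ∀ i → renT L (liftR L k ρ) (liftS L k σ i) ≡ liftS L k τ i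
  liftR-liftS k {σ} {ρ} {τ} h = ≗-split k
    (λ j → trans (cong (renT L (liftR L k ρ)) (liftS-↑ˡ k j))
             (trans (cong var (liftR-↑ˡ k j)) (sym (liftS-↑ˡ k j))))
    (λ j → trans (cong (renT L (liftR L k ρ)) (liftS-↑ʳ k j)) (trans (renT-↑ʳ k ρ (σ j))
             (trans (cong (renT L (k ↑ʳ_)) (h j)) (sym (liftS-↑ʳ k j)))))

  mutual
    renT-subT : {σ : Fin n → STm L m} {ρ : Fin m → Fin p} {τ : Fin n → STm L p}
              → (∀ i → renT L ρ (σ i) ≡ τ i) → ∀ t → renT L ρ (subT L σ t) ≡ subT L τ t
    renT-subT h (var i)    = h i
    renT-subT h (app f as) = cong (app f) (renA-subA h as)

    renA-subA : {σ : Fin n → STm L m} {ρ : Fin m → Fin p} {τ : Fin n → STm L p}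
              → (∀ i → renT L ρ (σ i) ≡ τ i) → ∀ {ks} (as : SArgs L n ks) → renA L ρ (subA L σ as) ≡ subA L τ as
    renA-subA h [] = refl
    renA-subA h (_∷_ {k} t as) = cong₂ _∷_ (renT-subT (liftR-liftS k h) t) (renA-subA h as)

  renF-subF : {σ : Fin n → STm L m} {ρ : Fin m → Fin p} {τ : Fin n → STm L p}
            → (∀ i → renT L ρ (σ i) ≡ τ i) → ∀ A → renF L ρ (subF L σ A) ≡ subF L τ A
  renF-subF h (atom P as) = cong (atom P) (renA-subA h as)
  renF-subF h (A ⊃ B) = cong₂ _⊃_ (renF-subF h A) (renF-subF h B)
  renF-subF h (A ∧ B) = cong₂ _∧_ (renF-subF h A) (renF-subF h B)
  renF-subF h (A ∨ B) = cong₂ _∨_ (renF-subF h A) (renF-subF h B)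
  renF-subF h ⊥ = refl
  renF-subF h (∀' A) = cong ∀' (renF-subF (liftR-liftS 1 h) A)
  renF-subF h (∃' A) = cong ∃' (renF-subF (liftR-liftS 1 h) A)

  -- Both sides are the substitution sending i to the weakening of `σ i`; this is why the two mixed
  -- laws precede composition of substitutions.
  subT-↑ʳ : ∀ k (σ : Fin n → STm L m) t → subT L (liftS L k σ) (renT L (k ↑ʳ_) t) ≡ renT L (k ↑ʳ_) (subT L σ t)
  subT-↑ʳ k σ t = trans (subT-renT (λ i → liftS-↑ʳ k i) t) (sym (renT-subT (λ _ → refl) t))

  liftS-liftS : ∀ k {σ : Fin n → STm L m} {σ' : Fin m → STm L p} {τ : Fin n → STm L p}
              → (∀ i → subT L σ' (σ i) ≡ τ i) → ∀ i → subT L (liftS L k σ') (liftS L k σ i) ≡ liftS L k τ i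
  liftS-liftS k {σ} {σ'} {τ} h = ≗-split k
    (λ j → trans (cong (subT L (liftS L k σ')) (liftS-↑ˡ k j))
             (trans (liftS-↑ˡ k j) (sym (liftS-↑ˡ k j))))
    (λ j → trans (cong (subT L (liftS L k σ')) (liftS-↑ʳ k j)) (trans (subT-↑ʳ k σ' (σ j))
             (trans (cong (renT L (k ↑ʳ_)) (h j)) (sym (liftS-↑ʳ k j)))))

  mutual
    subT-subT : {σ : Fin n → STm L m} {σ' : Fin m → STm L p} {τ : Fin n → STm L p}
              → (∀ i → subT L σ' (σ i) ≡ τ i) → ∀ t → subT L σ' (subT L σ t) ≡ subT L τ t
    subT-subT h (var i)    = h i
    subT-subT h (app f as) = cong (app f) (subA-subA h as)

    subA-subA : {σ : Fin n → STm L m} {σ' : Fin m → STm L p} {τ : Fin n → STm L p}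
              → (∀ i → subT L σ' (σ i) ≡ τ i) → ∀ {ks} (as : SArgs L n ks) → subA L σ' (subA L σ as) ≡ subA L τ as
    subA-subA h [] = refl
    subA-subA h (_∷_ {k} t as) = cong₂ _∷_ (subT-subT (liftS-liftS k h) t) (subA-subA h as)

  subF-subF : {σ : Fin n → STm L m} {σ' : Fin m → STm L p} {τ : Fin n → STm L p}
            → (∀ i → subT L σ' (σ i) ≡ τ i) → ∀ A → subF L σ' (subF L σ A) ≡ subF L τ A
  subF-subF h (atom P as) = cong (atom P) (subA-subA h as)
  subF-subF h (A ⊃ B) = cong₂ _⊃_ (subF-subF h A) (subF-subF h B)
  subF-subF h (A ∧ B) = cong₂ _∧_ (subF-subF h A) (subF-subF h B)
  subF-subF h (A ∨ B) = cong₂ _∨_ (subF-subF h A) (subF-subF h B)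
  subF-subF h ⊥ = refl
  subF-subF h (∀' A) = cong ∀' (subF-subF (liftS-liftS 1 h) A)
  subF-subF h (∃' A) = cong ∃' (subF-subF (liftS-liftS 1 h) A)

  -- Evaluation of σ-terms in binding logic

  -- Over m ambient variables, an element of sort n is a source term with n extra
  -- variables, and an element of sort ⟨n,p⟩ substitutes such terms for the p extra
  -- variables while fixing the ambient ones. Vectors, rather than functions, make
  -- the rules of σ hold up to ≡.
  D : ℕ → Sort → Set
  D m (tm p)   = STm L (p + m)
  D m (sb n p) = Vec (STm L (n + m)) p

  Env : ℕ → List Sort → Set
  Env m = All (D m)

  get : Env m Ξ → Var L Ξ s → D m s
  get (d ∷ η) vz     = d
  get (d ∷ η) (vs x) = get η x

  ext : ∀ n → Vec (STm L (n + m)) p → Fin (p + m) → STm L (n + m)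
  ext {p = p} n v i = [ lookup v , (λ j → var (n ↑ʳ j)) ]′ (splitAt p i)

  -- The body of a k-ary binder at sort p has k + p extra variables over m in L', but k bound
  -- variables over p + m in the source. The cast changes only the type of an index, not its value
  -- in ℕ.
  assoc : ∀ k p m → Fin ((k + p) + m) → Fin (k + (p + m))
  assoc k p m = cast (+-assoc k p m)

  mutual
    eval : Env m Ξ → Term L Ξ s → D m s
    eval η (var x)         = get η x
    eval η (fn f p ts)     = app f (evalArgs η (Lang.farity L f) ts)
    eval {m = m} η (cst i) = var (i ↑ˡ m)
    eval η (_[_] {n} t s)  = subT L (ext n (eval η s)) (eval η t)
    eval {m = m} η idS     = tabulate λ i → var (i ↑ˡ m)
    eval η (t ∙ s)         = eval η t ∷ eval η s
    eval {m = m} η ↑       = tabulate λ i → var (suc i ↑ˡ m)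
    eval η (_∘_ {q = q} s u) = mapV (subT L (ext q (eval η u))) (eval η s)

    evalArgs : Env m Ξ → ∀ ks → Terms L Ξ (map (tmPlus L p) ks) → SArgs L (p + m) ks
    evalArgs η [] [] = []
    evalArgs {m = m} {p = p} η (k ∷ ks) (t ∷ ts) = renT L (assoc k p m) (eval η t) ∷ evalArgs η ks ts

  evalAtom : Env m Ξ → ∀ ks → Terms L Ξ (map tm ks) → SArgs L m ks
  evalAtom η [] [] = []
  evalAtom η (k ∷ ks) (t ∷ ts) = eval η t ∷ evalAtom η ks ts

  ext-↑ˡ : ∀ n (v : Vec (STm L (n + m)) p) i → ext n v (i ↑ˡ m) ≡ lookup v i
  ext-↑ˡ n v = copair-↑ˡ

  ext-↑ʳ : ∀ n (v : Vec (STm L (n + m)) p) i → ext n v (p ↑ʳ i) ≡ var (n ↑ʳ i)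
  ext-↑ʳ {p = p} n v = copair-↑ʳ {k = p}

  ext-id : ∀ n i → ext {m} n (tabulate λ i → var (i ↑ˡ m)) i ≡ var i
  ext-id {m = m} n = ≗-split n
    (λ j → trans (ext-↑ˡ n v j) (lookup∘tabulate (λ i → var (i ↑ˡ m)) j)) (ext-↑ʳ n v)
    where
    v : Vec (STm L (n + m)) n
    v = tabulate λ i → var (i ↑ˡ m)

  ext-∘ : ∀ n q (v : Vec (STm L (n + m)) p) (u : Vec (STm L (q + m)) n)
        → ∀ i → subT L (ext q u) (ext n v i) ≡ ext q (mapV (subT L (ext q u)) v) i
  ext-∘ {p = p} n q v u = ≗-split p
    (λ j → trans (cong (subT L (ext q u)) (ext-↑ˡ n v j))
             (trans (sym (lookup-map j (subT L (ext q u)) v)) (sym (ext-↑ˡ q (mapV (subT L (ext q u)) v) j))))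
    (λ j → trans (cong (subT L (ext q u)) (ext-↑ʳ n v j))
             (trans (ext-↑ʳ q u j) (sym (ext-↑ʳ q (mapV (subT L (ext q u)) v) j))))

  -- Composing a block of variables with u selects entries of u. This is the common content of the
  -- σ-rules in which `idS` or `↑` meets another substitution.
  map-ext-tabulate : ∀ q (u : Vec (STm L (q + m)) n) (f : Fin p → Fin n)
             → mapV (subT L (ext q u)) (tabulate λ i → var (f i ↑ˡ m)) ≡ tabulate λ i → lookup u (f i)
  map-ext-tabulate q u f = trans (sym (tabulate-∘ _ _)) (tabulate-cong λ i → ext-↑ˡ q u (f i))

  -- The shift of an index by j follows the recursion of `_⊕_`, so it matches the sort of `⇑`
  -- definitionally.
  shiftIx : ∀ j → Fin p → Fin (j ⊕ p)
  shiftIx zero    i = i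
  shiftIx (suc j) i = shiftIx j (suc i)

  toℕ-shiftIx : ∀ j (i : Fin p) → toℕ (shiftIx j i) ≡ j + toℕ i
  toℕ-shiftIx zero    i = refl
  toℕ-shiftIx (suc j) i = trans (toℕ-shiftIx j (suc i)) (+-suc j (toℕ i))

  eval-⇑ : (η : Env m Ξ) → ∀ j → eval η (⇑ L j p) ≡ tabulate λ i → var (shiftIx j i ↑ˡ m)
  eval-⇑ η zero          = refl
  eval-⇑ η (suc zero)    = refl
  eval-⇑ {m = m} {p = p} η (suc (suc j)) rewrite eval-⇑ {p = suc p} η (suc j) =
    trans (map-ext-tabulate (suc j ⊕ suc p) (tabulate f) suc) (tabulate-cong λ i → lookup∘tabulate f (suc i))
    where
    f : Fin (suc p) → STm L ((suc (suc j) ⊕ p) + m)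
    f i = var (shiftIx (suc j) i ↑ˡ m)

  lookup-⇑ : (η : Env m Ξ) → ∀ j (i : Fin p) → lookup (eval η (⇑ L j p)) i ≡ var (shiftIx j i ↑ˡ m)
  lookup-⇑ η j i = trans (cong (λ v → lookup v i) (eval-⇑ η j)) (lookup∘tabulate _ i)

  eval-oneUp : (η : Env m Ξ) → ∀ j (v : Fin ((j ⊕ suc p) + m)) → toℕ v ≡ j
             → eval η (oneUp L j p) ≡ var v
  eval-oneUp η zero v e = cong var (toℕ-injective (sym e))
  eval-oneUp {m = m} η (suc j) v e = trans (lookup-⇑ η (suc j) zero) (cong var (toℕ-injective
    (trans (toℕ-↑ˡ _ m) (trans (toℕ-shiftIx (suc j) zero) (trans (+-identityʳ _) (sym e))))))

  ⊕-assoc : ∀ j q m → (j ⊕ q) + m ≡ j + (q + m)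
  ⊕-assoc j q m = trans (cong (_+ m) (⊕≡+ j q)) (+-assoc j q m)

  ext-⇑ : (η : Env m Ξ) → ∀ j (θ : Fin (q + m) → Fin ((j ⊕ q) + m)) → (∀ i → toℕ (θ i) ≡ j + toℕ i)
        → ∀ i → ext (j ⊕ q) (eval η (⇑ L j q)) i ≡ var (θ i)
  ext-⇑ {m = m} {q = q} η j θ h = ≗-split q
    (λ i → trans (ext-↑ˡ (j ⊕ q) (eval η (⇑ L j q)) i) (trans (lookup-⇑ η j i) (cong var (toℕ-injective
      (trans (toℕ-↑ˡ _ m) (trans (toℕ-shiftIx j i) (trans (cong (j +_) (sym (toℕ-↑ˡ i m))) (sym (h (i ↑ˡ m))))))))))
    (λ i → trans (ext-↑ʳ (j ⊕ q) (eval η (⇑ L j q)) i) (cong var (toℕ-injective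
      (trans (toℕ-↑ʳ (j ⊕ q) i) (trans (⊕-assoc j q (toℕ i)) (trans (cong (j +_) (sym (toℕ-↑ʳ q i))) (sym (h (q ↑ʳ i)))))))))

  -- Indices are described by their value in ℕ, so that no cast along j ⊕ m ≡ j + m
  -- is needed.
  chain-↑ˡ : (η : Env m Ξ) (s : Term L Ξ (sb q p)) → ∀ j r (a : Fin r) (v : Fin ((j ⊕ (r + q)) + m))
           → toℕ v ≡ j + toℕ a → lookup (eval η (chain L s j r)) (a ↑ˡ p) ≡ var v
  chain-↑ˡ η s j (suc r) zero    v e = eval-oneUp η j v (trans e (+-identityʳ j))
  chain-↑ˡ η s j (suc r) (suc a) v e = chain-↑ˡ η s (suc j) r a v (trans e (+-suc j (toℕ a)))

  -- The counter j grows by one for each of the r constants in front, so the tail that is finally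
  -- reached is s followed by the shift by j + r.
  chain-↑ʳ : (η : Env m Ξ) (s : Term L Ξ (sb q p)) → ∀ j r (b : Fin p) (θ : Fin (q + m) → Fin ((j ⊕ (r + q)) + m))
           → (∀ i → toℕ (θ i) ≡ (j + r) + toℕ i)
           → lookup (eval η (chain L s j r)) (r ↑ʳ b) ≡ renT L θ (lookup (eval η s) b)
  chain-↑ʳ {q = q} η s j zero b θ h =
    trans (lookup-map b _ (eval η s))
      (subT-var (ext-⇑ η j θ (λ i → trans (h i) (cong (_+ toℕ i) (+-identityʳ j)))) (lookup (eval η s) b))
  chain-↑ʳ η s j (suc r) b θ h =
    chain-↑ʳ η s (suc j) r b θ (λ i → trans (h i) (cong (_+ toℕ i) (+-suc j r)))

  assoc-ll : ∀ k {p} (a : Fin k) → assoc k p m ((a ↑ˡ p) ↑ˡ m) ≡ a ↑ˡ (p + m)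
  assoc-ll {m = m} k {p} a = toℕ-injective (trans (toℕ-cast _ _) (trans (toℕ-↑ˡ (a ↑ˡ p) m)
    (trans (toℕ-↑ˡ a p) (sym (toℕ-↑ˡ a (p + m))))))

  assoc-rl : ∀ k (b : Fin p) → assoc k p m ((k ↑ʳ b) ↑ˡ m) ≡ k ↑ʳ (b ↑ˡ m)
  assoc-rl {m = m} k b = toℕ-injective (trans (toℕ-cast _ _) (trans (toℕ-↑ˡ (k ↑ʳ b) m)
    (trans (toℕ-↑ʳ k b) (sym (trans (toℕ-↑ʳ k _) (cong (k +_) (toℕ-↑ˡ b m)))))))

  assoc-r : ∀ k p (c : Fin m) → assoc k p m ((k + p) ↑ʳ c) ≡ k ↑ʳ (p ↑ʳ c)
  assoc-r k p c = toℕ-injective (trans (toℕ-cast _ _) (trans (toℕ-↑ʳ (k + p) c)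
    (trans (+-assoc k p (toℕ c)) (sym (trans (toℕ-↑ʳ k _) (cong (k +_) (toℕ-↑ʳ p c)))))))

  -- The chain 1.1[↑]⋯s∘↑^k is the σ-notation for lifting under k binders. The three cases are a
  -- variable bound here, an entry of s, and an ambient variable. This is what validates `r-fn`.
  assoc-ext : (η : Env m Ξ) (s : Term L Ξ (sb q p)) → ∀ k i
    → liftS L k (ext q (eval η s)) (assoc k p m i)
      ≡ renT L (assoc k q m) (ext (k + q) (eval η (chain L s 0 k)) i)
  assoc-ext {m = m} {q = q} {p = p} η s k = ≗-split (k + p) (≗-split k
      (λ a → trans (cong (liftS L k σ) (assoc-ll k a)) (trans (liftS-↑ˡ k a)
        (sym (trans (cong (renT L (assoc k q m)) (trans (ext-↑ˡ (k + q) v (a ↑ˡ p))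
               (chain-↑ˡ η s 0 k a ((a ↑ˡ q) ↑ˡ m) (trans (toℕ-↑ˡ (a ↑ˡ q) m) (toℕ-↑ˡ a q)))))
          (cong var (assoc-ll k a))))))
      (λ b → trans (cong (liftS L k σ) (assoc-rl k b)) (trans (liftS-↑ʳ k (b ↑ˡ m))
        (trans (cong (renT L (k ↑ʳ_)) (ext-↑ˡ q (eval η s) b))
        (sym (trans (cong (renT L (assoc k q m)) (trans (ext-↑ˡ (k + q) v (k ↑ʳ b)) (chain-↑ʳ η s 0 k b θ toℕ-θ)))
          (renT-renT {ρ = θ} assoc-θ (lookup (eval η s) b))))))))
      (λ c → trans (cong (liftS L k σ) (assoc-r k p c)) (trans (liftS-↑ʳ k (p ↑ʳ c))
        (trans (cong (renT L (k ↑ʳ_)) (ext-↑ʳ q (eval η s) c))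
        (sym (trans (cong (renT L (assoc k q m)) (ext-↑ʳ (k + q) v c)) (cong var (assoc-r k q c)))))))
    where
    σ = ext q (eval η s)
    v = eval η (chain L s 0 k)

    θ : Fin (q + m) → Fin ((k + q) + m)
    θ i = cast (sym (+-assoc k q m)) (k ↑ʳ i)

    toℕ-θ : ∀ i → toℕ (θ i) ≡ k + toℕ i
    toℕ-θ i = trans (toℕ-cast _ _) (toℕ-↑ʳ k i)

    assoc-θ : ∀ i → assoc k q m (θ i) ≡ k ↑ʳ i
    assoc-θ i = toℕ-injective (trans (toℕ-cast (+-assoc k q m) (θ i)) (toℕ-cast _ (k ↑ʳ i)))

  eval-push : (η : Env m Ξ) (s : Term L Ξ (sb q p)) → ∀ ks (ts : Terms L Ξ (map (tmPlus L p) ks))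
    → subA L (ext q (eval η s)) (evalArgs η ks ts) ≡ evalArgs η ks (pushArgs L s ks ts)
  eval-push η s [] [] = refl
  eval-push η s (k ∷ ks) (t ∷ ts) = cong₂ _∷_
    (trans (subT-renT (λ _ → refl) (eval η t))
      (sym (renT-subT (λ i → sym (assoc-ext η s k i)) (eval η t))))
    (eval-push η s ks ts)

  eval-↦ : (η : Env m Ξ) {t u : Term L Ξ s} → _↦_ L t u → eval η t ≡ eval η u
  eval-↦ {m = m} η (r-num {n} {p} i e) = sym (trans (lookup-⇑ η (suc n) zero) (cong (λ j → var (j ↑ˡ m))
    (toℕ-injective (trans (toℕ-shiftIx {suc p} (suc n) zero) (trans (+-identityʳ _) (sym e))))))
  eval-↦ η r-one = refl
  eval-↦ η (r-id {n} {t}) = subT-id (ext-id n) (eval η t)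
  eval-↦ η (r-clos {m} {n} {t = t} {s} {s'}) = subT-subT (ext-∘ n m (eval η s) (eval η s')) (eval η t)
  eval-↦ η (r-idl {q = q} {s}) = trans (map-ext-tabulate q (eval η s) (λ i → i)) (tabulate∘lookup (eval η s))
  eval-↦ η (r-shcons {q = q} {t} {s}) = trans (map-ext-tabulate q (eval η (t ∙ s)) suc) (tabulate∘lookup (eval η s))
  eval-↦ η (r-assoc {q = q} {r} {s₁} {s₂} {s₃}) =
    trans (sym (mapV-∘ _ _ (eval η s₁)))
      (mapV-cong (subT-subT (ext-∘ q r (eval η s₂) (eval η s₃))) (eval η s₁))
  eval-↦ η r-map = refl
  eval-↦ η (r-idr {q = q} {s}) = trans (mapV-cong (subT-id (ext-id q)) (eval η s)) (mapV-id (eval η s))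
  eval-↦ η r-vid = refl
  -- Surjective pairing: a substitution for suc p variables is a head and a tail. The head is 1[s]
  -- by computation, and only the tail needs an argument.
  eval-↦ η (r-scons {n} {s = s}) with eval η s
  ... | x ∷ xs = cong (x ∷_) (trans (map-ext-tabulate n (x ∷ xs) suc) (tabulate∘lookup xs))
  eval-↦ η (r-fn f ts s) = cong (app f) (eval-push η s (Lang.farity L f) ts)

  mutual
    eval-⟶ : (η : Env m Ξ) {t u : Term L Ξ s} → _⟶_ L t u → eval η t ≡ eval η u
    eval-⟶ η (root r)  = eval-↦ η r
    eval-⟶ η (fn-c {f} r) = cong (app f) (evalArgs-⟶ η (Lang.farity L f) r)
    eval-⟶ η (clos₁ r) = cong (subT L _) (eval-⟶ η r)
    eval-⟶ η (clos₂ {n} {t = t} r) = cong (λ v → subT L (ext n v) (eval η t)) (eval-⟶ η r)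
    eval-⟶ η (cons₁ r) = cong (_∷ _) (eval-⟶ η r)
    eval-⟶ η (cons₂ r) = cong (_ ∷_) (eval-⟶ η r)
    eval-⟶ η (comp₁ r) = cong (mapV _) (eval-⟶ η r)
    eval-⟶ η (comp₂ {q = q} {s = s} r) = cong (λ v → mapV (subT L (ext q v)) (eval η s)) (eval-⟶ η r)

    evalArgs-⟶ : (η : Env m Ξ) → ∀ ks {ts us : Terms L Ξ (map (tmPlus L p) ks)}
               → _⟶s_ L ts us → evalArgs η ks ts ≡ evalArgs η ks us
    evalArgs-⟶ η (k ∷ ks) (hd r) = cong (λ t → renT L _ t ∷ _) (eval-⟶ η r)
    evalArgs-⟶ η (k ∷ ks) (tl r) = cong (_ ∷_) (evalArgs-⟶ η ks r)

  evalAtom-⟶ : (η : Env m Ξ) → ∀ ks {ts us : Terms L Ξ (map tm ks)}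
             → _⟶s_ L ts us → evalAtom η ks ts ≡ evalAtom η ks us
  evalAtom-⟶ η (k ∷ ks) (hd r) = cong (_∷ _) (eval-⟶ η r)
  evalAtom-⟶ η (k ∷ ks) (tl r) = cong (_ ∷_) (evalAtom-⟶ η ks r)

  -- Renaming of ambient variables

  renD : (Fin m → Fin m') → ∀ s → D m s → D m' s
  renD ρ (tm p)   = renT L (liftR L p ρ)
  renD ρ (sb n p) = mapV (renT L (liftR L n ρ))

  renE : (Fin m → Fin m') → Env m Ξ → Env m' Ξ
  renE ρ = mapAll (renD ρ _)

  renD-id : ∀ s (d : D m s) → renD (λ i → i) s d ≡ d
  renD-id (tm p)   d = renT-id (liftR-id p (λ _ → refl)) d
  renD-id (sb n p) d = trans (mapV-cong (renT-id (liftR-id n (λ _ → refl))) d) (mapV-id d)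

  renD-∘ : (ρ : Fin m → Fin n) (ρ' : Fin n → Fin p) → ∀ s d → renD ρ' s (renD ρ s d) ≡ renD (λ i → ρ' (ρ i)) s d
  renD-∘ ρ ρ' (tm p)   d = renT-renT (liftR-liftR p (λ _ → refl)) d
  renD-∘ ρ ρ' (sb n p) d = trans (sym (mapV-∘ _ _ d)) (mapV-cong (renT-renT (liftR-liftR n (λ _ → refl))) d)

  renE-id : (η : Env m Ξ) → renE (λ i → i) η ≡ η
  renE-id []                 = refl
  renE-id (_∷_ {x = s} d η) = cong₂ _∷_ (renD-id s d) (renE-id η)

  renE-∘ : (ρ : Fin m → Fin n) (ρ' : Fin n → Fin p) (η : Env m Ξ) → renE ρ' (renE ρ η) ≡ renE (λ i → ρ' (ρ i)) η
  renE-∘ ρ ρ' []                = refl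
  renE-∘ ρ ρ' (_∷_ {x = s} d η) = cong₂ _∷_ (renD-∘ ρ ρ' s d) (renE-∘ ρ ρ' η)

  get-renE : (ρ : Fin m → Fin m') (η : Env m Ξ) (x : Var L Ξ s) → get (renE ρ η) x ≡ renD ρ s (get η x)
  get-renE ρ (d ∷ η) vz     = refl
  get-renE ρ (d ∷ η) (vs x) = get-renE ρ η x

  assoc-liftR : (ρ : Fin m → Fin m') → ∀ k p i
              → assoc k p m' (liftR L (k + p) ρ i) ≡ liftR L k (liftR L p ρ) (assoc k p m i)
  assoc-liftR {m} {m'} ρ k p = ≗-split (k + p) (≗-split k
    (λ a → trans (cong (assoc k p m') (liftR-↑ˡ (k + p) (a ↑ˡ p))) (trans (assoc-ll k a)
      (sym (trans (cong (liftR L k (liftR L p ρ)) (assoc-ll k a)) (liftR-↑ˡ k a)))))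
    (λ b → trans (cong (assoc k p m') (liftR-↑ˡ (k + p) (k ↑ʳ b))) (trans (assoc-rl k b)
      (sym (trans (cong (liftR L k (liftR L p ρ)) (assoc-rl k b)) (trans (liftR-↑ʳ k (b ↑ˡ m))
        (cong (k ↑ʳ_) (liftR-↑ˡ p b))))))))
    (λ c → trans (cong (assoc k p m') (liftR-↑ʳ (k + p) c)) (trans (assoc-r k p (ρ c))
      (sym (trans (cong (liftR L k (liftR L p ρ)) (assoc-r k p c)) (trans (liftR-↑ʳ k (p ↑ʳ c))
        (cong (k ↑ʳ_) (liftR-↑ʳ p c)))))))

  ext-ren : (ρ : Fin m → Fin m') → ∀ n (v : Vec (STm L (n + m)) p) i
          → ext n (renD ρ (sb n p) v) (liftR L p ρ i) ≡ renT L (liftR L n ρ) (ext n v i)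
  ext-ren {p = p} ρ n v = ≗-split p
    (λ j → trans (cong (ext n v') (liftR-↑ˡ p j)) (trans (ext-↑ˡ n v' j)
      (trans (lookup-map j _ v) (cong (renT L (liftR L n ρ)) (sym (ext-↑ˡ n v j))))))
    (λ j → trans (cong (ext n v') (liftR-↑ʳ p j)) (trans (ext-↑ʳ n v' (ρ j))
      (sym (trans (cong (renT L (liftR L n ρ)) (ext-↑ʳ n v j)) (cong var (liftR-↑ʳ n j))))))
    where v' = renD ρ (sb n p) v

  subT-ext-ren : (ρ : Fin m → Fin m') → ∀ n (v : Vec (STm L (n + m)) p) t
    → subT L (ext n (renD ρ (sb n p) v)) (renT L (liftR L p ρ) t) ≡ renT L (liftR L n ρ) (subT L (ext n v) t)
  subT-ext-ren ρ n v t = trans (subT-renT (ext-ren ρ n v) t) (sym (renT-subT (λ _ → refl) t))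

  tabulate-ren : (ρ : Fin m → Fin m') (f : Fin p → Fin n)
    → tabulate (λ i → var (f i ↑ˡ m')) ≡ mapV (renT L (liftR L n ρ)) (tabulate (λ i → var (f i ↑ˡ m)))
  tabulate-ren {n = n} ρ f = trans (tabulate-cong (λ i → cong var (sym (liftR-↑ˡ n (f i))))) (tabulate-∘ _ _)

  mutual
    -- Naturality in the ambient variables: the value of a term at a later situation is the renamed
    -- earlier value, so forcing can follow it along extensions.
    eval-renE : (ρ : Fin m → Fin m') (η : Env m Ξ) (t : Term L Ξ s) → eval (renE ρ η) t ≡ renD ρ s (eval η t)
    eval-renE ρ η (var x)         = get-renE ρ η x
    eval-renE ρ η (fn f p ts)     = cong (app f) (evalArgs-renE ρ η (Lang.farity L f) ts)
    eval-renE ρ η (cst {n} i)     = cong var (sym (liftR-↑ˡ n i))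
    eval-renE ρ η (_[_] {n} t s)  = trans (cong₂ (λ v → subT L (ext n v)) (eval-renE ρ η s) (eval-renE ρ η t))
                                      (subT-ext-ren ρ n (eval η s) (eval η t))
    eval-renE ρ η idS             = tabulate-ren ρ (λ i → i)
    eval-renE ρ η (t ∙ s)         = cong₂ _∷_ (eval-renE ρ η t) (eval-renE ρ η s)
    eval-renE ρ η ↑               = tabulate-ren ρ suc
    eval-renE ρ η (_∘_ {q = q} s u) =
      trans (cong₂ (λ v → mapV (subT L (ext q v))) (eval-renE ρ η u) (eval-renE ρ η s))
        (trans (sym (mapV-∘ _ _ (eval η s)))
          (trans (mapV-cong (subT-ext-ren ρ q (eval η u)) (eval η s)) (mapV-∘ _ _ (eval η s))))

    evalArgs-renE : (ρ : Fin m → Fin m') (η : Env m Ξ) → ∀ ks (ts : Terms L Ξ (map (tmPlus L p) ks))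
      → evalArgs (renE ρ η) ks ts ≡ renA L (liftR L p ρ) (evalArgs η ks ts)
    evalArgs-renE ρ η [] [] = refl
    evalArgs-renE {p = p} ρ η (k ∷ ks) (t ∷ ts) = cong₂ _∷_
      (trans (cong (renT L _) (eval-renE ρ η t))
        (trans (renT-renT (assoc-liftR ρ k p) (eval η t)) (sym (renT-renT (λ _ → refl) (eval η t)))))
      (evalArgs-renE ρ η ks ts)

  evalAtom-renE : (ρ : Fin m → Fin m') (η : Env m Ξ) → ∀ ks (ts : Terms L Ξ (map tm ks))
    → evalAtom (renE ρ η) ks ts ≡ renA L ρ (evalAtom η ks ts)
  evalAtom-renE ρ η [] [] = refl
  evalAtom-renE ρ η (k ∷ ks) (t ∷ ts) = cong₂ _∷_ (eval-renE ρ η t) (evalAtom-renE ρ η ks ts)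

  -- Evaluation under renaming and substitution of L' variables

  module _ {η : Env m Θ} {θ : Env m Ξ} (ρ : ∀ {s} → Var L Ξ s → Var L Θ s)
           (h : ∀ {s} (x : Var L Ξ s) → get η (ρ x) ≡ get θ x) where
    mutual
      eval-renT' : (t : Term L Ξ s) → eval η (renT' L ρ t) ≡ eval θ t
      eval-renT' (var x)        = h x
      eval-renT' (fn f p ts)    = cong (app f) (evalArgs-renTs' (Lang.farity L f) ts)
      eval-renT' (cst i)        = refl
      eval-renT' (_[_] {n} t s) = cong₂ (λ v → subT L (ext n v)) (eval-renT' s) (eval-renT' t)
      eval-renT' idS            = refl
      eval-renT' (t ∙ s)        = cong₂ _∷_ (eval-renT' t) (eval-renT' s)
      eval-renT' ↑              = refl
      eval-renT' (_∘_ {q = q} s u) = cong₂ (λ v → mapV (subT L (ext q v))) (eval-renT' u) (eval-renT' s)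

      evalArgs-renTs' : ∀ ks (ts : Terms L Ξ (map (tmPlus L p) ks))
                      → evalArgs η ks (renTs' L ρ ts) ≡ evalArgs θ ks ts
      evalArgs-renTs' [] [] = refl
      evalArgs-renTs' (k ∷ ks) (t ∷ ts) = cong₂ (λ t as → renT L _ t ∷ as) (eval-renT' t) (evalArgs-renTs' ks ts)

    evalAtom-renTs' : ∀ ks (ts : Terms L Ξ (map tm ks)) → evalAtom η ks (renTs' L ρ ts) ≡ evalAtom θ ks ts
    evalAtom-renTs' [] [] = refl
    evalAtom-renTs' (k ∷ ks) (t ∷ ts) = cong₂ _∷_ (eval-renT' t) (evalAtom-renTs' ks ts)

  module _ {η : Env m Θ} {θ : Env m Ξ} (σ : ∀ {s} → Var L Ξ s → Term L Θ s)
           (h : ∀ {s} (x : Var L Ξ s) → eval η (σ x) ≡ get θ x) where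
    mutual
      eval-subT' : (t : Term L Ξ s) → eval η (subT' L σ t) ≡ eval θ t
      eval-subT' (var x)        = h x
      eval-subT' (fn f p ts)    = cong (app f) (evalArgs-subTs' (Lang.farity L f) ts)
      eval-subT' (cst i)        = refl
      eval-subT' (_[_] {n} t s) = cong₂ (λ v → subT L (ext n v)) (eval-subT' s) (eval-subT' t)
      eval-subT' idS            = refl
      eval-subT' (t ∙ s)        = cong₂ _∷_ (eval-subT' t) (eval-subT' s)
      eval-subT' ↑              = refl
      eval-subT' (_∘_ {q = q} s u) = cong₂ (λ v → mapV (subT L (ext q v))) (eval-subT' u) (eval-subT' s)

      evalArgs-subTs' : ∀ ks (ts : Terms L Ξ (map (tmPlus L p) ks))
                      → evalArgs η ks (subTs' L σ ts) ≡ evalArgs θ ks ts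
      evalArgs-subTs' [] [] = refl
      evalArgs-subTs' (k ∷ ks) (t ∷ ts) = cong₂ (λ t as → renT L _ t ∷ as) (eval-subT' t) (evalArgs-subTs' ks ts)

    evalAtom-subTs' : ∀ ks (ts : Terms L Ξ (map tm ks)) → evalAtom η ks (subTs' L σ ts) ≡ evalAtom θ ks ts
    evalAtom-subTs' [] [] = refl
    evalAtom-subTs' (k ∷ ks) (t ∷ ts) = cong₂ _∷_ (eval-subT' t) (evalAtom-subTs' ks ts)

  -- Forcing

  record Sit (Ξ : List Sort) : Set where
    constructor sit
    field
      {size}  : ℕ
      lhs rhs : List (SForm L size)
      env     : Env size Ξ
  open Sit

  _▷_ : (κ : Sit Ξ) → D (size κ) s → Sit (s ∷ Ξ)
  κ ▷ d = sit (lhs κ) (rhs κ) (d ∷ env κ)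

  Prov : Sit Ξ → Set
  Prov κ = LK L (size κ) (lhs κ) (rhs κ)

  infix 4 _≤_ _⊩_
  -- Extensions may bring new variables as well as new propositions, as eigenvariables require. The
  -- two sides are compared as sets; contraction in LK makes up for multiplicities.
  record _≤_ {Ξ} (κ κ' : Sit Ξ) : Set where
    field
      ren  : Fin (size κ) → Fin (size κ')
      lhs⊆ : ∀ {A} → A ∈ lhs κ → renF L ren A ∈ lhs κ'
      rhs⊆ : ∀ {A} → A ∈ rhs κ → renF L ren A ∈ rhs κ'
      env≡ : env κ' ≡ renE ren (env κ)
  open _≤_

  private variable
    κ κ' κ'' : Sit Ξ
    A B : SForm L n
    Γ Δ : List (SForm L n)

  widen : ∀ {Γ Γ' Δ Δ' : List (SForm L m)} {η : Env m Ξ}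
        → (∀ {A} → A ∈ Γ → A ∈ Γ') → (∀ {A} → A ∈ Δ → A ∈ Δ') → sit Γ Δ η ≤ sit Γ' Δ' η
  widen {η = η} i j = record
    { ren = λ i → i
    ; lhs⊆ = λ {A} x → subst (_∈ _) (sym (renF-id (λ _ → refl) A)) (i x)
    ; rhs⊆ = λ {A} x → subst (_∈ _) (sym (renF-id (λ _ → refl) A)) (j x)
    ; env≡ = sym (renE-id η) }

  freshen : ∀ {Γ Δ : List (SForm L m)} {η : Env m Ξ}
          → sit Γ Δ η ≤ sit (map (wkS L) Γ) (map (wkS L) Δ) (renE suc η)
  freshen = record { ren = suc ; lhs⊆ = ∈-map⁺ (wkS L) ; rhs⊆ = ∈-map⁺ (wkS L) ; env≡ = refl }

  ≤-refl : κ ≤ κ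
  ≤-refl = widen (λ x → x) (λ x → x)

  ≤-trans : κ ≤ κ' → κ' ≤ κ'' → κ ≤ κ''
  ≤-trans {κ = κ} a b = record
    { ren = λ i → ren b (ren a i)
    ; lhs⊆ = λ {A} x → subst (_∈ _) (renF-renF (λ _ → refl) A) (lhs⊆ b (lhs⊆ a x))
    ; rhs⊆ = λ {A} x → subst (_∈ _) (renF-renF (λ _ → refl) A) (rhs⊆ b (rhs⊆ a x))
    ; env≡ = trans (env≡ b) (trans (cong (renE (ren b)) (env≡ a)) (renE-∘ (ren a) (ren b) (env κ))) }

  renSit : (a : κ ≤ κ') → D (size κ) s → D (size κ') s
  renSit a = renD (ren a) _

  ≤-▷ : (a : κ ≤ κ') (d : D (size κ) s) → (κ ▷ d) ≤ (κ' ▷ renSit a d)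
  ≤-▷ a d = record { ren = ren a ; lhs⊆ = lhs⊆ a ; rhs⊆ = rhs⊆ a ; env≡ = cong (_ ∷_) (env≡ a) }

  pop : Sit (s ∷ Ξ) → Sit Ξ
  pop κ = sit (lhs κ) (rhs κ) (All.tail (env κ))

  ≤-pop : {d : D (size κ) s} → (κ ▷ d) ≤ κ' → κ ≤ pop κ'
  ≤-pop a = record { ren = ren a ; lhs⊆ = lhs⊆ a ; rhs⊆ = rhs⊆ a ; env≡ = cong All.tail (env≡ a) }

  Refutes : Sit Ξ → (Sit Ξ → Set) → Set
  Refutes κ X = ∀ {κ'} → κ ≤ κ' → X κ' → Prov κ'

  -- A double-negation translation in which provability of the sequent of the
  -- situation plays the role of falsity.
  _⊩_ : Sit Ξ → Form L Ξ → Set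
  κ ⊩ atom P ts = ∀ {κ'} → κ ≤ κ' → LK L (size κ') (lhs κ') (atom P (evalAtom (env κ') _ ts) ∷ rhs κ')
  κ ⊩ (A ⊃ B)   = ∀ {κ'} → κ ≤ κ' → κ' ⊩ A → κ' ⊩ B
  κ ⊩ (A ∧ B)   = κ ⊩ A × κ ⊩ B
  κ ⊩ (A ∨ B)   = ∀ {κ'} → κ ≤ κ' → Refutes κ' (_⊩ A) → Refutes κ' (_⊩ B) → Prov κ'
  κ ⊩ ⊥         = ∀ {κ'} → κ ≤ κ' → Prov κ'
  κ ⊩ ∀' s A    = ∀ {κ'} → κ ≤ κ' → (d : D (size κ') s) → (κ' ▷ d) ⊩ A
  κ ⊩ ∃' s A    = ∀ {κ'} → κ ≤ κ' → (∀ {κ''} → κ' ≤ κ'' → (d : D (size κ'') s) → (κ'' ▷ d) ⊩ A → Prov κ'') → Prov κ'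

  mono : ∀ A → κ ≤ κ' → κ ⊩ A → κ' ⊩ A
  mono (atom P ts) a f = λ b → f (≤-trans a b)
  mono (A ⊃ B)     a f = λ b → f (≤-trans a b)
  mono (A ∧ B)     a (f , g) = mono A a f , mono B a g
  mono (A ∨ B)     a f = λ b → f (≤-trans a b)
  mono ⊥           a f = λ b → f (≤-trans a b)
  mono (∀' s A)    a f = λ b → f (≤-trans a b)
  mono (∃' s A)    a f = λ b → f (≤-trans a b)

  contrR∈ : A ∈ Δ → LK L n Γ (A ∷ Δ) → LK L n Γ Δ
  contrR∈ i d with ∈⇒↭ i
  ... | _ , e = exch ↭-refl (↭-sym e) (contrR (exch ↭-refl (prep _ e) d))

  identity : ∀ Γ Δ → LK L n (A ∷ Γ) (A ∷ Δ)
  identity []      []      = ax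
  identity []      (B ∷ Δ) = exch ↭-refl (swap _ _ ↭-refl) (weakR (identity [] Δ))
  identity (B ∷ Γ) Δ       = exch (swap _ _ ↭-refl) ↭-refl (weakL (identity Γ Δ))

  identity∈ : A ∈ Γ → LK L n Γ (A ∷ Δ)
  identity∈ i with ∈⇒↭ i
  ... | _ , e = exch (↭-sym e) ↭-refl (identity _ _)

  weakR₂ : LK L n Γ (A ∷ Δ) → LK L n Γ (A ∷ B ∷ Δ)
  weakR₂ d = exch ↭-refl (swap _ _ ↭-refl) (weakR d)

  -- For an atom, the atom itself is first added on the right; any later proof of it is then
  -- contracted into that copy. The clauses for ∨, ⊥ and ∃ are already in continuation form, and ⊃,
  -- ∧ and ∀ reduce to their components.
  stable : ∀ A {κ : Sit Ξ} → (∀ {κ'} → κ ≤ κ' → Refutes κ' (_⊩ A) → Prov κ') → κ ⊩ A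
  stable (atom P ts) nn {κ'} a = nn (≤-trans a (widen (λ x → x) there)) λ {κ''} b f →
    contrR∈ (subst (_∈ rhs κ'') (cong (atom P) (sym (trans (cong (λ η → evalAtom η _ ts) (env≡ b))
              (evalAtom-renE (ren b) (env κ') _ ts)))) (rhs⊆ b (here refl)))
      (f ≤-refl)
  stable (A ⊃ B) nn a x = stable B λ b k → nn (≤-trans a b) λ c f → k c (f ≤-refl (mono A (≤-trans b c) x))
  stable (A ∧ B) nn = stable A (λ a k → nn a λ b f → k b (proj₁ f)) , stable B (λ a k → nn a λ b f → k b (proj₂ f))
  stable (A ∨ B) nn a k l = nn a λ b f → f ≤-refl (λ c → k (≤-trans b c)) (λ c → l (≤-trans b c))
  stable ⊥ nn a = nn a λ b f → f ≤-refl
  -- The renamed value d is the head of the later environment. Matching on that environment exposes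
  -- it, so that it can be renamed once more along c.
  stable (∀' s A) nn a d = stable A λ
    { {sit _ _ (_ ∷ _)} b k → nn (≤-trans a (≤-pop b)) λ c f → k (≤-▷ c _) (f ≤-refl (renSit c _)) }
  stable (∃' s A) nn a k = nn a λ b f → f ≤-refl (λ c → k (≤-trans b c))

  -- Transport of forcing between related environments

  EnvRel : List Sort → List Sort → Set₁
  EnvRel Ξ Θ = ∀ {m} → Env m Ξ → Env m Θ → Set

  data _⇑▷_ (R : EnvRel Ξ Θ) (s : Sort) : EnvRel (s ∷ Ξ) (s ∷ Θ) where
    _∷_ : {η : Env m Ξ} {θ : Env m Θ} (d : D m s) → R η θ → (R ⇑▷ s) (d ∷ η) (d ∷ θ)

  -- Sim R A B: A and B have the same interpretation in R-related environments. It
  -- covers reduction, weakening and instantiation at once.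
  data Sim : (∀ {m} → Env m Ξ → Env m Θ → Set) → Form L Ξ → Form L Θ → Set₁ where
    atom : ∀ {R : EnvRel Ξ Θ} {P ts us} → (∀ {m} {η : Env m Ξ} {θ} → R η θ → evalAtom η _ ts ≡ evalAtom θ _ us)
         → Sim R (atom P ts) (atom P us)
    _⊃_  : ∀ {R : EnvRel Ξ Θ} {A A' B B'} → Sim R A A' → Sim R B B' → Sim R (A ⊃ B) (A' ⊃ B')
    _∧_  : ∀ {R : EnvRel Ξ Θ} {A A' B B'} → Sim R A A' → Sim R B B' → Sim R (A ∧ B) (A' ∧ B')
    _∨_  : ∀ {R : EnvRel Ξ Θ} {A A' B B'} → Sim R A A' → Sim R B B' → Sim R (A ∨ B) (A' ∨ B')
    ⊥    : ∀ {R : EnvRel Ξ Θ} → Sim R ⊥ ⊥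
    ∀'   : ∀ {R : EnvRel Ξ Θ} {s A A'} → Sim (R ⇑▷ s) A A' → Sim R (∀' s A) (∀' s A')
    ∃'   : ∀ {R : EnvRel Ξ Θ} {s A A'} → Sim (R ⇑▷ s) A A' → Sim R (∃' s A) (∃' s A')

  -- Forcing quantifies over extensions, which rename ambient variables; a useful relation has to
  -- survive this.
  Natural : EnvRel Ξ Θ → Set
  Natural R = ∀ {m m'} (ρ : Fin m → Fin m') {η θ} → R η θ → R (renE ρ η) (renE ρ θ)

  ⇑▷-natural : {R : EnvRel Ξ Θ} → Natural R → Natural (R ⇑▷ s)
  ⇑▷-natural nat ρ (d ∷ r) = renD ρ _ d ∷ nat ρ r

  module _ {R : EnvRel Ξ Θ} (nat : Natural R) {Γ Δ : List (SForm L m)} {η : Env m Ξ} {θ : Env m Θ} (r : R η θ) where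

    -- By `env≡` the renaming determines the later environment, so an extension of one situation can
    -- be replayed on the related one.
    followʳ : sit Γ Δ η ≤ κ → Σ[ θ' ∈ Env (size κ) Θ ] sit Γ Δ θ ≤ sit (lhs κ) (rhs κ) θ' × R (env κ) θ'
    followʳ a = renE (ren a) θ ,
      record { ren = ren a ; lhs⊆ = lhs⊆ a ; rhs⊆ = rhs⊆ a ; env≡ = refl } ,
      subst (λ η → R η _) (sym (env≡ a)) (nat (ren a) r)

    followˡ : sit Γ Δ θ ≤ κ → Σ[ η' ∈ Env (size κ) Ξ ] sit Γ Δ η ≤ sit (lhs κ) (rhs κ) η' × R η' (env κ)
    followˡ a = renE (ren a) η ,
      record { ren = ren a ; lhs⊆ = lhs⊆ a ; rhs⊆ = rhs⊆ a ; env≡ = refl } ,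
      subst (R _) (sym (env≡ a)) (nat (ren a) r)

  mutual
    sim-to : {R : EnvRel Ξ Θ} → Natural R → ∀ {A B} → Sim R A B → {Γ Δ : List (SForm L m)} → ∀ {η θ}
           → R η θ → sit Γ Δ η ⊩ A → sit Γ Δ θ ⊩ B
    sim-to nat (atom e) r f a with followˡ nat r a
    ... | _ , b , r' = subst (λ as → LK L _ _ (atom _ as ∷ _)) (e r') (f b)
    sim-to nat (S ⊃ T) r f a x with followˡ nat r a
    ... | _ , b , r' = sim-to nat T r' (f b (sim-from nat S r' x))
    sim-to nat (S ∧ T) r (f , g) = sim-to nat S r f , sim-to nat T r g
    sim-to nat (S ∨ T) r f a k l with followˡ nat r a
    ... | _ , b , r' = f b (refutes-from nat S r' k) (refutes-from nat T r' l)
    sim-to nat ⊥ r f a with followˡ nat r a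
    ... | _ , b , r' = f b
    sim-to nat (∀' S) r f a d with followˡ nat r a
    ... | _ , b , r' = sim-to (⇑▷-natural nat) S (d ∷ r') (f b d)
    sim-to nat (∃' S) r f a k with followˡ nat r a
    ... | _ , b , r' = f b λ c d x → let _ , c' , r'' = followʳ nat r' c in
      k c' d (sim-to (⇑▷-natural nat) S (d ∷ r'') x)

    sim-from : {R : EnvRel Ξ Θ} → Natural R → ∀ {A B} → Sim R A B → {Γ Δ : List (SForm L m)} → ∀ {η θ}
             → R η θ → sit Γ Δ θ ⊩ B → sit Γ Δ η ⊩ A
    sim-from nat (atom e) r f a with followʳ nat r a
    ... | _ , b , r' = subst (λ as → LK L _ _ (atom _ as ∷ _)) (sym (e r')) (f b)
    sim-from nat (S ⊃ T) r f a x with followʳ nat r a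
    ... | _ , b , r' = sim-from nat T r' (f b (sim-to nat S r' x))
    sim-from nat (S ∧ T) r (f , g) = sim-from nat S r f , sim-from nat T r g
    sim-from nat (S ∨ T) r f a k l with followʳ nat r a
    ... | _ , b , r' = f b (refutes-to nat S r' k) (refutes-to nat T r' l)
    sim-from nat ⊥ r f a with followʳ nat r a
    ... | _ , b , r' = f b
    sim-from nat (∀' S) r f a d with followʳ nat r a
    ... | _ , b , r' = sim-from (⇑▷-natural nat) S (d ∷ r') (f b d)
    sim-from nat (∃' S) r f a k with followʳ nat r a
    ... | _ , b , r' = f b λ c d x → let _ , c' , r'' = followˡ nat r' c in
      k c' d (sim-from (⇑▷-natural nat) S (d ∷ r'') x)

    refutes-to : {R : EnvRel Ξ Θ} → Natural R → ∀ {A B} → Sim R A B → {Γ Δ : List (SForm L m)} → ∀ {η θ}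
               → R η θ → Refutes (sit Γ Δ η) (_⊩ A) → Refutes (sit Γ Δ θ) (_⊩ B)
    refutes-to nat S r k a x with followˡ nat r a
    ... | _ , b , r' = k b (sim-from nat S r' x)

    refutes-from : {R : EnvRel Ξ Θ} → Natural R → ∀ {A B} → Sim R A B → {Γ Δ : List (SForm L m)} → ∀ {η θ}
                 → R η θ → Refutes (sit Γ Δ θ) (_⊩ B) → Refutes (sit Γ Δ η) (_⊩ A)
    refutes-from nat S r k a x with followʳ nat r a
    ... | _ , b , r' = k b (sim-to nat S r' x)

  -- Below a quantifier `_≡_` turns into `_≡_ ⇑▷ s`, a different relation. Inclusion in equality is
  -- the property that is preserved.
  _⊆≡ : EnvRel Ξ Ξ → Set
  R ⊆≡ = ∀ {m} {η θ : Env m _} → R η θ → η ≡ θ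

  ⇑▷-≡ : {R : EnvRel Ξ Ξ} → R ⊆≡ → (R ⇑▷ s) ⊆≡
  ⇑▷-≡ h (d ∷ r) = cong (d ∷_) (h r)

  sim-refl : {R : EnvRel Ξ Ξ} → R ⊆≡ → ∀ A → Sim R A A
  sim-refl h (atom P ts) = atom λ r → cong (λ η → evalAtom η _ ts) (h r)
  sim-refl h (A ⊃ B)     = sim-refl h A ⊃ sim-refl h B
  sim-refl h (A ∧ B)     = sim-refl h A ∧ sim-refl h B
  sim-refl h (A ∨ B)     = sim-refl h A ∨ sim-refl h B
  sim-refl h ⊥           = ⊥
  sim-refl h (∀' s A)    = ∀' (sim-refl (⇑▷-≡ h) A)
  sim-refl h (∃' s A)    = ∃' (sim-refl (⇑▷-≡ h) A)

  sim-⟶ : {R : EnvRel Ξ Ξ} → R ⊆≡ → ∀ {A B} → _⟶F_ L A B → Sim R A B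
  sim-⟶ h (atom-c {ts = ts} q) = atom λ { {η = η} r →
    trans (evalAtom-⟶ η _ q) (cong (λ η → evalAtom η _ _) (h r)) }
  sim-⟶ h (⊃₁ q)  = sim-⟶ h q ⊃ sim-refl h _
  sim-⟶ h (⊃₂ q)  = sim-refl h _ ⊃ sim-⟶ h q
  sim-⟶ h (∧₁ q)  = sim-⟶ h q ∧ sim-refl h _
  sim-⟶ h (∧₂ q)  = sim-refl h _ ∧ sim-⟶ h q
  sim-⟶ h (∨₁ q)  = sim-⟶ h q ∨ sim-refl h _
  sim-⟶ h (∨₂ q)  = sim-refl h _ ∨ sim-⟶ h q
  sim-⟶ h (∀-c q) = ∀' (sim-⟶ (⇑▷-≡ h) q)
  sim-⟶ h (∃-c q) = ∃' (sim-⟶ (⇑▷-≡ h) q)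

  sim-renF' : {R : EnvRel Θ Ξ} (ρ : ∀ {s} → Var L Ξ s → Var L Θ s)
    → (∀ {m} {η : Env m Θ} {θ} → R η θ → ∀ {s} (x : Var L Ξ s) → get η (ρ x) ≡ get θ x)
    → ∀ A → Sim R (renF' L ρ A) A
  sim-renF' ρ h (atom P ts) = atom λ r → evalAtom-renTs' ρ (h r) _ ts
  sim-renF' ρ h (A ⊃ B)     = sim-renF' ρ h A ⊃ sim-renF' ρ h B
  sim-renF' ρ h (A ∧ B)     = sim-renF' ρ h A ∧ sim-renF' ρ h B
  sim-renF' ρ h (A ∨ B)     = sim-renF' ρ h A ∨ sim-renF' ρ h B
  sim-renF' ρ h ⊥           = ⊥
  sim-renF' ρ h (∀' s A)    = ∀' (sim-renF' (liftV L ρ) (λ { (d ∷ r) vz → refl ; (d ∷ r) (vs x) → h r x }) A)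
  sim-renF' ρ h (∃' s A)    = ∃' (sim-renF' (liftV L ρ) (λ { (d ∷ r) vz → refl ; (d ∷ r) (vs x) → h r x }) A)

  liftσ-sound : {R : EnvRel Θ Ξ} (σ : ∀ {s} → Var L Ξ s → Term L Θ s)
    → (∀ {m} {η : Env m Θ} {θ} → R η θ → ∀ {s} (x : Var L Ξ s) → eval η (σ x) ≡ get θ x)
    → ∀ {s m} {η : Env m (s ∷ Θ)} {θ} → (R ⇑▷ s) η θ
    → ∀ {s'} (x : Var L (s ∷ Ξ) s') → eval η (liftσ L σ x) ≡ get θ x
  liftσ-sound σ h (d ∷ r) vz     = refl
  liftσ-sound σ h (d ∷ r) (vs x) = trans (eval-renT' vs (λ _ → refl) (σ x)) (h r x)

  sim-subF' : {R : EnvRel Θ Ξ} (σ : ∀ {s} → Var L Ξ s → Term L Θ s)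
    → (∀ {m} {η : Env m Θ} {θ} → R η θ → ∀ {s} (x : Var L Ξ s) → eval η (σ x) ≡ get θ x)
    → ∀ A → Sim R (subF' L σ A) A
  sim-subF' σ h (atom P ts) = atom λ r → evalAtom-subTs' σ (h r) _ ts
  sim-subF' σ h (A ⊃ B)     = sim-subF' σ h A ⊃ sim-subF' σ h B
  sim-subF' σ h (A ∧ B)     = sim-subF' σ h A ∧ sim-subF' σ h B
  sim-subF' σ h (A ∨ B)     = sim-subF' σ h A ∨ sim-subF' σ h B
  sim-subF' σ h ⊥           = ⊥
  sim-subF' σ h (∀' s A)    = ∀' (sim-subF' (liftσ L σ) (liftσ-sound σ h) A)
  sim-subF' σ h (∃' s A)    = ∃' (sim-subF' (liftσ L σ) (liftσ-sound σ h) A)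

  ≡σ-to : ∀ {A B : Form L Ξ} → _≡σ_ L A B → κ ⊩ A → κ ⊩ B
  ≡σ-to ε           = λ x → x
  ≡σ-to (fwd q ◅ e) = λ x → ≡σ-to e (sim-to (λ { ρ refl → refl }) (sim-⟶ {R = _≡_} (λ r → r) q) refl x)
  ≡σ-to (bwd q ◅ e) = λ x → ≡σ-to e (sim-from (λ { ρ refl → refl }) (sim-⟶ {R = _≡_} (λ r → r) q) refl x)

  ≡σ-from : ∀ {A B : Form L Ξ} → _≡σ_ L A B → κ ⊩ B → κ ⊩ A
  ≡σ-from e = ≡σ-to (symmetric _ e)

  Popped : EnvRel (s ∷ Ξ) Ξ
  Popped η θ = All.tail η ≡ θ

  popped-natural : Natural (Popped {s} {Ξ})
  popped-natural ρ {_ ∷ _} refl = refl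

  sim-wk : (A : Form L Ξ) → Sim (Popped {s}) (wkT L A) A
  sim-wk = sim-renF' vs λ { {η = _ ∷ _} refl x → refl }

  ⊩-wk : ∀ {A : Form L Ξ} {d : D (size κ) s} → κ ⊩ A → (κ ▷ d) ⊩ wkT L A
  ⊩-wk {A = A} = sim-from popped-natural (sim-wk A) refl

  refutes-wk : ∀ {A : Form L Ξ} {d : D (size κ) s} → Refutes κ (_⊩ A) → Refutes (κ ▷ d) (_⊩ wkT L A)
  refutes-wk {A = A} = refutes-from popped-natural (sim-wk A) refl

  -- The semantic form of instantiation: substituting t amounts to extending the environment by the
  -- value of t.
  Pushed : Term L Ξ s → EnvRel Ξ (s ∷ Ξ)
  Pushed t η θ = eval η t ∷ η ≡ θ

  pushed-natural : (t : Term L Ξ s) → Natural (Pushed t)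
  pushed-natural t ρ {η} refl = cong (_∷ _) (eval-renE ρ η t)

  sim-inst : (A : Form L (s ∷ Ξ)) (t : Term L Ξ s) → Sim (Pushed t) (instT L A t) A
  sim-inst A t = sim-subF' _ (λ { refl vz → refl ; refl (vs x) → refl }) A

  inst-to : ∀ (A : Form L (s ∷ Ξ)) t {κ} → κ ⊩ instT L A t → (κ ▷ eval (env κ) t) ⊩ A
  inst-to A t = sim-to (pushed-natural t) (sim-inst A t) refl

  inst-from : ∀ (A : Form L (s ∷ Ξ)) t {κ} → (κ ▷ eval (env κ) t) ⊩ A → κ ⊩ instT L A t
  inst-from A t = sim-from (pushed-natural t) (sim-inst A t) refl

  -- Without ambient variables a sort can be empty, for instance `STm L 0` in a language without
  -- closed terms. One ambient variable inhabits every sort.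
  inhabitant : ∀ s → D (suc m) s
  inhabitant (tm p)   = var (p ↑ʳ zero)
  inhabitant (sb n p) = tabulate λ _ → var (n ↑ʳ zero)

  -- Soundness of LK modulo σ for forcing

  Forced Refuted : Sit Ξ → List (Form L Ξ) → Set
  Forced κ  = All (κ ⊩_)
  Refuted κ = All λ A → Refutes κ (_⊩ A)

  forced-mono : ∀ {Γ : List (Form L Ξ)} → κ ≤ κ' → Forced κ Γ → Forced κ' Γ
  forced-mono a = mapAll λ {A} → mono A a

  refuted-mono : ∀ {Δ : List (Form L Ξ)} → κ ≤ κ' → Refuted κ Δ → Refuted κ' Δ
  refuted-mono a []      = []
  refuted-mono a (k ∷ δ) = (λ b → k (≤-trans a b)) ∷ refuted-mono a δ

  forced-wk : ∀ {Γ : List (Form L Ξ)} {d : D (size κ) s} → Forced κ Γ → Forced (κ ▷ d) (map (wkT L) Γ)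
  forced-wk γ = All.map⁺ (mapAll (λ {A} → ⊩-wk {A = A}) γ)

  refuted-wk : ∀ {Δ : List (Form L Ξ)} {d : D (size κ) s} → Refuted κ Δ → Refuted (κ ▷ d) (map (wkT L) Δ)
  refuted-wk []                = []
  refuted-wk (_∷_ {x = A} k δ) = refutes-wk {A = A} k ∷ refuted-wk δ

  -- Right-hand propositions act as continuations. `⊃R` and `∀R` must force the proposition that
  -- their premise only allows to be refuted, and `stable` bridges this gap; the remaining right
  -- rules call the continuations directly.
  sound : ∀ {Γ Δ : List (Form L Ξ)} → LKσ L Ξ Γ Δ → (κ : Sit Ξ) → Forced κ Γ → Refuted κ Δ → Prov κ
  sound (ax e) κ (x ∷ []) (k ∷ []) = k ≤-refl (≡σ-to e x)
  sound (cut {B = B} e d d') κ γ δ = sound d' κ γ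
    ((λ a x → sound d _ (≡σ-from e x ∷ forced-mono a γ) (refuted-mono a δ)) ∷ δ)
  sound (contrL e e' d) κ (x ∷ γ) δ = sound d κ (≡σ-to e x ∷ ≡σ-to e' x ∷ γ) δ
  sound (contrR e e' d) κ γ (k ∷ δ) =
    sound d κ γ ((λ a x → k a (≡σ-from e x)) ∷ (λ a x → k a (≡σ-from e' x)) ∷ δ)
  sound (weakL d) κ (_ ∷ γ) δ = sound d κ γ δ
  sound (weakR d) κ γ (_ ∷ δ) = sound d κ γ δ
  sound (exch p q d) κ γ δ = sound d κ (All-resp-↭ (↭-sym p) γ) (All-resp-↭ (↭-sym q) δ)
  sound (⊃L {A = A} {B} e d d') κ (x ∷ γ) δ = sound d κ γ
    ((λ a y → sound d' _ (≡σ-to e x a y ∷ forced-mono a γ) (refuted-mono a δ)) ∷ δ)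
  sound (⊃R {A = A} {B} e d) κ γ (k ∷ δ) = k ≤-refl (≡σ-from e λ a x → stable B λ b l →
    sound d _ (mono A b x ∷ forced-mono (≤-trans a b) γ) (l ∷ refuted-mono (≤-trans a b) δ))
  sound (∧L e d) κ (x ∷ γ) δ = sound d κ (proj₁ (≡σ-to e x) ∷ proj₂ (≡σ-to e x) ∷ γ) δ
  sound (∧R e d d') κ γ (k ∷ δ) = sound d κ γ ((λ a x → sound d' _ (forced-mono a γ)
    ((λ b y → k (≤-trans a b) (≡σ-from e (mono _ b x , y))) ∷ refuted-mono a δ)) ∷ δ)
  sound (∨L e d d') κ (x ∷ γ) δ = ≡σ-to e x ≤-refl
    (λ a y → sound d _ (y ∷ forced-mono a γ) (refuted-mono a δ))
    (λ a y → sound d' _ (y ∷ forced-mono a γ) (refuted-mono a δ))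
  sound (∨R e d) κ γ (k ∷ δ) = k ≤-refl (≡σ-from e λ a l r →
    sound d _ (forced-mono a γ) ((λ b → l b) ∷ (λ b → r b) ∷ refuted-mono a δ))
  sound (⊥L e) κ (x ∷ γ) δ = ≡σ-to e x ≤-refl
  sound (∀L {A = A} t e e' d) κ (x ∷ γ) δ =
    sound d κ (≡σ-from e' (inst-from A t (≡σ-to e x ≤-refl (eval (env κ) t))) ∷ γ) δ
  sound (∀R {A = A} e d) κ γ (k ∷ δ) = k ≤-refl (≡σ-from e λ a x → stable A λ
    { {sit _ _ (_ ∷ _)} b l → sound d _ (forced-wk (forced-mono (≤-trans a (≤-pop b)) γ))
        (l ∷ refuted-wk (refuted-mono (≤-trans a (≤-pop b)) δ)) })
  sound (∃L e d) κ (x ∷ γ) δ = ≡σ-to e x ≤-refl λ a y z →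
    sound d _ (z ∷ forced-wk (forced-mono a γ)) (refuted-wk (refuted-mono a δ))
  sound (∃R {A = A} t e e' d) κ γ (k ∷ δ) = sound d κ γ ((λ a x → k a (≡σ-from e λ b l →
    l ≤-refl _ (inst-to A t (mono _ b (≡σ-to e' x))))) ∷ δ)
  sound (fresh s d) κ γ δ = fresh (sound d (_ ▷ inhabitant s)
    (forced-wk (forced-mono freshen γ)) (refuted-wk (refuted-mono freshen δ)))

  -- Evaluation of pre-cooked terms

  eval-⇑₀ : ∀ (η : Env m Ξ) k t → subT L (ext k (eval η (⇑₀ L k))) t ≡ renT L (k ↑ʳ_) t
  -- A vector of length 0 leaves only ambient variables, so `ext` computes to the weakening by k
  -- whatever the form of `⇑₀`.
  eval-⇑₀ η k t = subT-var (λ _ → refl) t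

  cookS : ∀ k → Env m Ξ → (Fin c → Fin k ⊎ Var L Ξ (tm 0)) → Fin c → STm L (k + m)
  cookS {m = m} k η τ i = [ (λ a → var (a ↑ˡ m)) , (λ x → renT L (k ↑ʳ_) (get η x)) ]′ (τ i)

  assoc-cookS : ∀ k p (η : Env m Ξ) (τ : Fin c → Fin p ⊎ Var L Ξ (tm 0)) i
    → renT L (assoc k p m) (cookS (k + p) η (extCls L k τ) i) ≡ liftS L k (cookS p η τ) i
  assoc-cookS {m = m} k p η τ = ≗-split k
    (λ a → trans (cong (λ z → renT L (assoc k p m) (f z)) (copair-↑ˡ a))
      (trans (cong var (assoc-ll k a)) (sym (liftS-↑ˡ k a))))
    (λ j → trans (cong (λ z → renT L (assoc k p m) (f z)) (copair-↑ʳ {k = k} j))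
      (trans (weakened (τ j)) (sym (liftS-↑ʳ k j))))
    where
    f : Fin (k + p) ⊎ Var L _ (tm 0) → STm L ((k + p) + m)
    f = [ (λ a → var (a ↑ˡ m)) , (λ x → renT L ((k + p) ↑ʳ_) (get η x)) ]′

    weakened : ∀ z → renT L (assoc k p m) (f (map₁ (k ↑ʳ_) z))
      ≡ renT L (k ↑ʳ_) ([ (λ a → var (a ↑ˡ m)) , (λ x → renT L (p ↑ʳ_) (get η x)) ]′ z)
    weakened (inj₁ b) = cong var (assoc-rl k b)
    weakened (inj₂ x) = trans (renT-renT (assoc-r k p) (get η x)) (sym (renT-renT (λ _ → refl) (get η x)))

  mutual
    -- Evaluation undoes pre-cooking: variables in the list stay bound, and the others receive their
    -- values weakened past that list.
    eval-FT : ∀ p (η : Env m Ξ) (τ : Fin c → Fin p ⊎ Var L Ξ (tm 0)) t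
            → eval η (FT L p τ t) ≡ subT L (cookS p η τ) t
    eval-FT p η τ (var i) with τ i
    ... | inj₁ a = refl
    ... | inj₂ x = eval-⇑₀ η p (get η x)
    eval-FT p η τ (app f as) = cong (app f) (eval-FA p η τ as)

    eval-FA : ∀ p (η : Env m Ξ) (τ : Fin c → Fin p ⊎ Var L Ξ (tm 0)) {ks} (as : SArgs L c ks)
            → evalArgs η ks (FA L p τ as) ≡ subA L (cookS p η τ) as
    eval-FA p η τ [] = refl
    eval-FA {m = m} p η τ (_∷_ {k} t as) = cong₂ _∷_
      (trans (cong (renT L (assoc k p m)) (eval-FT (k + p) η (extCls L k τ) t))
        (renT-subT (assoc-cookS k p η τ) t))
      (eval-FA p η τ as)

  cookS-pred : ∀ k (η : Env m Ξ) (τ : Fin c → Var L Ξ (tm 0)) i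
    → cookS k η (predCls L k τ) i ≡ liftS L k (λ j → get η (τ j)) i
  cookS-pred {m = m} k η τ = ≗-split k
    (λ a → trans (cong f (copair-↑ˡ a)) (sym (liftS-↑ˡ k a)))
    (λ j → trans (cong f (copair-↑ʳ {k = k} j)) (sym (liftS-↑ʳ k j)))
    where
    f : Fin k ⊎ Var L _ (tm 0) → STm L (k + m)
    f = [ (λ a → var (a ↑ˡ m)) , (λ x → renT L (k ↑ʳ_) (get η x)) ]′

  evalAtom-FPA : ∀ (η : Env m Ξ) (τ : Fin c → Var L Ξ (tm 0)) {ks} (as : SArgs L c ks)
    → evalAtom η ks (FPA L τ as) ≡ subA L (λ j → get η (τ j)) as
  evalAtom-FPA η τ [] = refl
  evalAtom-FPA η τ (_∷_ {k} t as) = cong₂ _∷_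
    (trans (eval-FT k η (predCls L k τ) t) (subT-cong (cookS-pred k η τ) t))
    (evalAtom-FPA η τ as)

  -- Forcing of pre-cooked propositions compared with provability

  _⟨_⟩ : SForm L n → Env m (replicate n (tm 0)) → SForm L m
  A ⟨ η ⟩ = subF L (λ i → get η (toVar L i)) A

  renF-⟨⟩ : (ρ : Fin m → Fin m') (η : Env m (replicate n (tm 0))) → ∀ A → renF L ρ (A ⟨ η ⟩) ≡ A ⟨ renE ρ η ⟩
  renF-⟨⟩ ρ η = renF-subF λ i → sym (get-renE ρ η (toVar L i))

  transfer : ∀ {κ κ' : Sit (replicate n (tm 0))} A (a : κ ≤ κ') → renF L (ren a) (A ⟨ env κ ⟩) ≡ A ⟨ env κ' ⟩
  transfer {κ = κ} A a = trans (renF-⟨⟩ (ren a) (env κ) A) (cong (A ⟨_⟩) (sym (env≡ a)))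

  ⟨⟩-eigen : ∀ (A : SForm L (suc n)) (η : Env m (replicate n (tm 0)))
    → A ⟨ var zero ∷ renE suc η ⟩ ≡ subF L (liftS L 1 (λ i → get η (toVar L i))) A
  ⟨⟩-eigen A η = subF-cong (λ { zero → refl ; (suc i) → get-renE suc η (toVar L i) }) A

  ⟨⟩-inst : ∀ (A : SForm L (suc n)) (t : STm L m) (η : Env m (replicate n (tm 0)))
    → instS L (subF L (liftS L 1 (λ i → get η (toVar L i))) A) t ≡ A ⟨ t ∷ η ⟩
  ⟨⟩-inst A t η = subF-subF
    (λ { zero → refl ; (suc i) → trans (subT-renT (λ _ → refl) (get η (toVar L i))) (subT-id (λ _ → refl) _) }) A

  mutual
    -- As in normalisation by evaluation: the situation is enlarged by the components or by an
    -- eigenvariable, forcing is used there, and the right rule of the connective closes the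
    -- derivation.
    reify : ∀ (A : SForm L n) κ → κ ⊩ pre L A → LK L (size κ) (lhs κ) (A ⟨ env κ ⟩ ∷ rhs κ)
    reify (atom P as) κ f =
      subst (λ as → LK L _ _ (atom P as ∷ _)) (evalAtom-FPA (env κ) (toVar L) as) (f ≤-refl)
    reify (A ⊃ B) κ f = ⊃R (reify B _ (f (widen there (λ x → x)) (assumed A (here refl))))
    reify (A ∧ B) κ (f , g) = ∧R (reify A κ f) (reify B κ g)
    reify (A ∨ B) κ f = ∨R (f (widen (λ x → x) (λ x → there (there x)))
      (denied A (here refl)) (denied B (there (here refl))))
    reify ⊥ κ f = weakR (f ≤-refl)
    reify (∀' A) κ f = ∀R (subst (λ B → LK L _ _ (B ∷ _)) (⟨⟩-eigen A (env κ)) (reify A _ (f freshen (var zero))))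
    -- The existential is placed on the right before any witness is known. Each witness found later
    -- yields it by `∃R`, and the new copy is contracted into the old one.
    reify (∃' A) κ f = f (widen (λ x → x) there) λ {κ''} a d x →
      contrR∈ (subst (_∈ rhs κ'') (transfer (∃' A) a) (rhs⊆ a (here refl)))
        (∃R d (subst (λ B → LK L _ _ (B ∷ _)) (sym (⟨⟩-inst A d (env κ''))) (reify A _ x)))

    -- Cut inverts the connectives: the given proof of A is cut against a small derivation that uses
    -- A on the left. The hypothesis covers all extensions because the clauses of forcing do.
    reflect : ∀ (A : SForm L n) κ → (∀ {κ'} → κ ≤ κ' → LK L (size κ') (lhs κ') (A ⟨ env κ' ⟩ ∷ rhs κ')) → κ ⊩ pre L A
    reflect (atom P as) κ p {κ'} a =
      subst (λ as → LK L _ _ (atom P as ∷ _)) (sym (evalAtom-FPA (env κ') (toVar L) as)) (p a)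
    reflect (A ⊃ B) κ p a x = reflect B _ λ b → cut _
      (⊃L (weakR₂ (reify A _ (mono (pre L A) b x))) (identity _ _))
      (weakR₂ (p (≤-trans a b)))
    reflect (A ∧ B) κ p =
      reflect A κ (λ a → cut _ (∧L (identity _ _)) (weakR₂ (p a))) ,
      reflect B κ (λ a → cut _ (∧L (identity∈ (there (here refl)))) (weakR₂ (p a)))
    reflect (A ∨ B) κ p a k l = cut _
      (∨L (k (widen there (λ x → x)) (assumed A (here refl))) (l (widen there (λ x → x)) (assumed B (here refl))))
      (p a)
    reflect ⊥ κ p a = cut ⊥ ⊥L (p a)
    reflect (∀' A) κ p a d = reflect A _ λ
      { {sit _ _ (d' ∷ η)} b → cut _
        (∀L d' (subst (λ B → LK L _ (B ∷ _) (A ⟨ d' ∷ η ⟩ ∷ _)) (sym (⟨⟩-inst A d' η)) (identity _ _)))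
        (weakR₂ (p (≤-trans a (≤-pop b)))) }
    -- The eigenvariable of `∃L` is itself the witness: its instance of A, now on the left, is
    -- forced by `assumed`.
    reflect (∃' A) κ p {κ'} a k = cut _
      (∃L (subst (λ B → LK L _ (B ∷ _) _) (⟨⟩-eigen A (env κ'))
        (k (≤-trans freshen (widen there (λ x → x))) (var zero) (assumed A (here refl)))))
      (p a)

    assumed : ∀ (A : SForm L n) {κ} → A ⟨ env κ ⟩ ∈ lhs κ → κ ⊩ pre L A
    assumed A {κ} i = reflect A κ λ {κ'} a → identity∈ (subst (_∈ lhs κ') (transfer A a) (lhs⊆ a i))

    denied : ∀ (A : SForm L n) {κ} → A ⟨ env κ ⟩ ∈ rhs κ → Refutes κ (_⊩ pre L A)
    denied A {κ} i {κ'} a x = contrR∈ (subst (_∈ rhs κ') (transfer A a) (rhs⊆ a i)) (reify A κ' x)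

  tabulateE : (Fin n → STm L m) → Env m (replicate n (tm 0))
  tabulateE {zero}  f = []
  tabulateE {suc n} f = f zero ∷ tabulateE λ i → f (suc i)

  get-tabulateE : (f : Fin n → STm L m) → ∀ i → get (tabulateE f) (toVar L i) ≡ f i
  get-tabulateE f zero    = refl
  get-tabulateE f (suc i) = get-tabulateE (λ i → f (suc i)) i

  ⟨⟩-var : ∀ (A : SForm L n) → A ⟨ tabulateE var ⟩ ≡ A
  ⟨⟩-var A = trans (subF-var (get-tabulateE var) A) (renF-id (λ _ → refl) A)

  -- The situation is the goal sequent with the identity environment. Its left side is forced and
  -- its right side refuted merely by membership, so soundness returns a proof of the sequent
  -- itself.
  LKσ⇒LK : ∀ (Γ Δ : List (SForm L n)) → LKσ L (replicate n (tm 0)) (map (pre L) Γ) (map (pre L) Δ) → LK L n Γ Δ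
  LKσ⇒LK Γ Δ d = sound d (sit Γ Δ (tabulateE var))
    (All.map⁺ (All.tabulate λ {A} i → assumed A (subst (_∈ Γ) (sym (⟨⟩-var A)) i)))
    (All.map⁺ (All.tabulate λ {A} i a → denied A (subst (_∈ Δ) (sym (⟨⟩-var A)) i) a))

  -- σ-convertibility and pre-cooking

  _≈_ : Term L Ξ s → Term L Ξ s → Set
  _≈_ = EqClosure (_⟶_ L)

  _≈s_ : Terms L Ξ ss → Terms L Ξ ss → Set
  _≈s_ = EqClosure (_⟶s_ L)

  -- Convertibility across sorts that are only propositionally equal; it spares
  -- casts along j ⊕ m ≡ j + m.
  infix 4 _≅_
  data _≅_ {Ξ} {s} (t : Term L Ξ s) : ∀ {s'} → Term L Ξ s' → Set where
    conv : ∀ {u} → t ≈ u → t ≅ u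

  ≅⇒≈ : {t u : Term L Ξ s} → t ≅ u → t ≈ u
  ≅⇒≈ (conv e) = e

  ≅-refl : {t : Term L Ξ s} → t ≅ t
  ≅-refl = conv ε

  ≅-sym : {t : Term L Ξ s} {u : Term L Ξ s'} → t ≅ u → u ≅ t
  ≅-sym (conv e) = conv (symmetric _ e)

  infixr 5 _⨾_
  _⨾_ : ∀ {s''} {t : Term L Ξ s} {u : Term L Ξ s'} {v : Term L Ξ s''} → t ≅ u → u ≅ v → t ≅ v
  conv e ⨾ conv e' = conv (e ◅◅ e')

  rule : {t u : Term L Ξ s} → _↦_ L t u → t ≅ u
  rule r = conv (return (root r))

  ≡⇒≅ : {t u : Term L Ξ s} → t ≡ u → t ≅ u
  ≡⇒≅ refl = ≅-refl

  []-cong : {t : Term L Ξ (tm p)} {t' : Term L Ξ (tm p')} {u : Term L Ξ (sb n p)} {u' : Term L Ξ (sb n' p')}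
          → t ≅ t' → u ≅ u' → t [ u ] ≅ t' [ u' ]
  []-cong (conv e) (conv e') = conv (gmap (_[ _ ]) clos₁ e ◅◅ gmap (_ [_]) clos₂ e')

  ∘-cong : {u : Term L Ξ (sb p n)} {u' : Term L Ξ (sb p' n')} {v : Term L Ξ (sb q p)} {v' : Term L Ξ (sb q' p')}
         → u ≅ u' → v ≅ v' → u ∘ v ≅ u' ∘ v'
  ∘-cong (conv e) (conv e') = conv (gmap (_∘ _) comp₁ e ◅◅ gmap (_ ∘_) comp₂ e')

  ∷-cong : {t u : Term L Ξ s} {ts us : Terms L Ξ ss} → t ≈ u → ts ≈s us → (t ∷ ts) ≈s (u ∷ us)
  ∷-cong e e' = gmap (_∷ _) hd e ◅◅ gmap (_ ∷_) tl e'

  cst-cong : {i : Fin n} {j : Fin n'} → n ≡ n' → toℕ i ≡ toℕ j → cst {Ξ = Ξ} i ≅ cst {L} {Ξ} j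
  cst-cong refl e = ≡⇒≅ (cong cst (toℕ-injective e))

  ↑-cong : n ≡ n' → ↑ {L} {Ξ} {n} ≅ ↑ {L} {Ξ} {n'}
  ↑-cong refl = ≅-refl

  -- The shift by k again, composed on the right so that its sort follows the recursion of `_+_`;
  -- `⇑` nests the other way and follows `_⊕_`.
  up : ∀ k n → Term L Ξ (sb (k + n) n)
  up zero    n = idS
  up (suc k) n = up k n ∘ ↑

  up-cong : k ≡ p → n ≡ n' → up {Ξ} k n ≅ up {Ξ} p n'
  up-cong refl refl = ≅-refl

  up-one : up {Ξ} 1 n ≅ ↑ {L} {Ξ} {n}
  up-one = rule r-idl

  ↑∘up : ∀ k n → ↑ {n = n} ∘ up {Ξ} k (suc n) ≅ up {Ξ} (suc k) n
  ↑∘up zero    n = rule r-idr ⨾ ≅-sym up-one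
  ↑∘up (suc k) n = ≅-sym (rule r-assoc) ⨾ ∘-cong (↑∘up k n) (↑-cong (+-suc k n))

  ⇑≅up : ∀ j m → ⇑ L {Ξ} j m ≅ up {Ξ} j m
  ⇑≅up zero          m = ≅-refl
  ⇑≅up (suc zero)    m = ≅-sym up-one
  ⇑≅up (suc (suc j)) m = ∘-cong ≅-refl (⇑≅up (suc j) (suc m)) ⨾ ↑∘up (suc j) m

  subst-≅ : (e : n ≡ n') (u : Term L Ξ (sb n p)) → subst (λ N → Term L Ξ (sb N p)) e u ≅ u
  subst-≅ refl u = ≅-refl

  ⇑₀≅up : ∀ m → ⇑₀ L {Ξ} m ≅ up {Ξ} m 0
  ⇑₀≅up m = subst-≅ (⊕-zero m) (⇑ L m 0) ⨾ ⇑≅up m 0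

  up∘up : ∀ a b n → up {Ξ} a n ∘ up b (a + n) ≅ up {Ξ} (b + a) n
  up∘up a zero    n = rule r-idr
  up∘up a (suc b) n = ≅-sym (rule r-assoc) ⨾ ∘-cong (up∘up a b n) (↑-cong (sym (+-assoc b a n)))

  ⇑₀∘up : ∀ a b → ⇑₀ L {Ξ} a ∘ up b a ≅ ⇑₀ L {Ξ} (b + a)
  ⇑₀∘up a b = ∘-cong (⇑₀≅up a) (up-cong refl (sym (+-identityʳ a))) ⨾ up∘up a b 0 ⨾ ≅-sym (⇑₀≅up (b + a))

  cst-zero-up : ∀ j p (i : Fin n) → toℕ i ≡ j → n ≡ j + suc p → cst i ≅ cst zero [ up {Ξ} j (suc p) ]
  cst-zero-up zero    p zero e refl = ≅-sym (rule r-id)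
  -- `r-num` is stated at a sort of the form suc n ⊕ suc p. The sort equation is brought to that
  -- form, and `go` matches on it while n is still a variable.
  cst-zero-up (suc j) p i e e' = go i e (trans e' (sym (⊕≡+ (suc j) (suc p))))
    where
    go : (i : Fin n) → toℕ i ≡ suc j → n ≡ suc j ⊕ suc p → cst i ≅ cst zero [ up {Ξ} (suc j) (suc p) ]
    go i e refl = rule (r-num {n = j} {p} i e) ⨾ []-cong ≅-refl (⇑≅up (suc j) (suc p))

  -- Here p counts the constants of sort n after i, which fixes the sort at which i is a shifted 1.
  codepth : (i : Fin n) → ∃[ p ] n ≡ toℕ i + suc p
  codepth {suc n} zero    = n , refl
  codepth {suc n} (suc i) with codepth i
  ... | p , e = p , cong suc e

  -- The constant is written as a shifted 1, the two shifts are composed, and the result is read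
  -- back as a constant.
  cst-up : ∀ k (i : Fin n) → cst i [ up {Ξ} k n ] ≅ cst (k ↑ʳ i)
  cst-up k i with codepth i
  ... | p , e =
    []-cong (cst-zero-up (toℕ i) p i refl e) (up-cong refl e)
    ⨾ rule r-clos
    ⨾ []-cong ≅-refl (up∘up (toℕ i) k (suc p))
    ⨾ ≅-sym (cst-zero-up (k + toℕ i) p (k ↑ʳ i) (toℕ-↑ʳ k i) (trans (cong (k +_) e) (sym (+-assoc k (toℕ i) (suc p)))))

  oneUp≅cst : ∀ j m (i : Fin n) → toℕ i ≡ j → n ≡ j + suc m → oneUp L {Ξ} j m ≅ cst {L} {Ξ} i
  oneUp≅cst zero    m zero e refl = ≅-refl
  oneUp≅cst (suc j) m i e e' = []-cong ≅-refl (⇑≅up (suc j) (suc m)) ⨾ ≅-sym (cst-zero-up (suc j) m i e e')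

  -- Chains and shifts as renamings of pre-cooked terms

  up∘chain : (s : Term L Ξ (sb q p)) → ∀ j r → up r p ∘ chain L s j r ≅ s ∘ up (j + r) q
  up∘chain s j zero    = rule r-idl ⨾ ∘-cong ≅-refl (⇑≅up j _ ⨾ up-cong (sym (+-identityʳ j)) refl)
  up∘chain s j (suc r) = rule r-assoc ⨾ ∘-cong ≅-refl (rule r-shcons) ⨾ up∘chain s (suc j) r
    ⨾ ∘-cong ≅-refl (up-cong (sym (+-suc j r)) refl)

  cst-suc : (i : Fin n) → cst (suc i) ≅ cst i [ ↑ {L} {Ξ} ]
  cst-suc i = ≅-sym (cst-up 1 i) ⨾ []-cong ≅-refl up-one

  module _ (s : Term L Ξ (sb q p)) (ρ : Fin p → Fin q) (act : ∀ b → cst b [ s ] ≅ cst {L} {Ξ} (ρ b)) where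

    -- The constant 1 takes the head of the chain, and a successor is i[↑], whose shift removes the
    -- head. After r removals `act` applies, followed by the shift that has accumulated in j.
    cst-chain : ∀ j r (i : Fin (r + p)) (v : Fin n) → toℕ v ≡ j + toℕ (liftR L r ρ i) → n ≡ j + (r + q)
              → cst i [ chain L s j r ] ≅ cst {L} {Ξ} v
    cst-chain j zero i v e e' =
      ≅-sym (rule r-clos)
      ⨾ []-cong (act i) (⇑≅up j q)
      ⨾ cst-up j (ρ i)
      ⨾ cst-cong (sym e') (trans (toℕ-↑ʳ j (ρ i)) (sym e))
    cst-chain j (suc r) zero v e e' = rule r-one ⨾ oneUp≅cst j (r + q) v (trans e (+-identityʳ j)) e'
    cst-chain j (suc r) (suc i) v e e' =
      []-cong (cst-suc i) ≅-refl
      ⨾ rule r-clos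
      ⨾ []-cong ≅-refl (rule r-shcons)
      ⨾ cst-chain (suc j) r i v (trans e (trans (cong (j +_) (toℕ-liftR-suc i)) (+-suc j _)))
          (trans e' (+-suc j (r + q)))
      where
      toℕ-liftR-suc : ∀ i → toℕ (liftR L (suc r) ρ (suc i)) ≡ suc (toℕ (liftR L r ρ i))
      toℕ-liftR-suc = ≗-split r
        (λ a → trans (cong toℕ (liftR-↑ˡ (suc r) (suc a))) (cong (λ z → suc (toℕ z)) (sym (liftR-↑ˡ r a))))
        (λ b → trans (cong toℕ (liftR-↑ʳ (suc r) b)) (cong (λ z → suc (toℕ z)) (sym (liftR-↑ʳ r b))))

  -- u acts on pre-cooked terms as the renaming ρ of the bound variables: it sends
  -- the constants along ρ and fixes the variables x [ ⇑₀ p ].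
  record Renames (u : Term L Ξ (sb q p)) (ρ : Fin p → Fin q) : Set where
    field
      on-cst : ∀ b → cst b [ u ] ≅ cst {L} {Ξ} (ρ b)
      on-⇑₀  : ⇑₀ L p ∘ u ≅ ⇑₀ L {Ξ} q
  open Renames

  -- For `on-⇑₀`, the shift by k + p is split. The part ↑^k cancels the k constants of the chain and
  -- leaves u∘↑^k; u is then absorbed by hypothesis and the shifts are recombined.
  renames-chain : ∀ {u : Term L Ξ (sb q p)} {ρ} → Renames u ρ → ∀ k → Renames (chain L u 0 k) (liftR L k ρ)
  on-cst (renames-chain {u = u} {ρ} r k) b = cst-chain u ρ (on-cst r) 0 k b (liftR L k ρ b) refl refl
  on-⇑₀ (renames-chain {q = q} {p} {u} r k) =
    ∘-cong (≅-sym (⇑₀∘up p k)) ≅-refl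
    ⨾ rule r-assoc
    ⨾ ∘-cong ≅-refl (up∘chain u 0 k)
    ⨾ ≅-sym (rule r-assoc)
    ⨾ ∘-cong (on-⇑₀ r) ≅-refl
    ⨾ ⇑₀∘up q k

  renames-up : ∀ k → Renames (up {Ξ} k p) (k ↑ʳ_)
  on-cst (renames-up k)         = cst-up k
  on-⇑₀ (renames-up {p = p} k) = ⇑₀∘up p k

  renames-⇑₀ : ∀ k → Renames (⇑₀ L {Ξ} k) (λ ())
  on-cst (renames-⇑₀ k) ()
  on-⇑₀ (renames-⇑₀ k) = rule r-idl

  extCls-↑ˡ : ∀ k (τ : Fin c → Fin m ⊎ Var L Ξ (tm 0)) a → extCls L k τ (a ↑ˡ c) ≡ inj₁ (a ↑ˡ m)
  extCls-↑ˡ k τ = copair-↑ˡ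

  extCls-↑ʳ : ∀ k (τ : Fin c → Fin m ⊎ Var L Ξ (tm 0)) j → extCls L k τ (k ↑ʳ j) ≡ map₁ (k ↑ʳ_) (τ j)
  extCls-↑ʳ k τ = copair-↑ʳ {k = k}

  extCls-map₁ : ∀ k {ρ : Fin p → Fin q} {ξ : Fin c → Fin c'}
      (τ : Fin c → Fin p ⊎ Var L Ξ (tm 0)) (τ' : Fin c' → Fin q ⊎ Var L Ξ (tm 0))
    → (∀ i → τ' (ξ i) ≡ map₁ ρ (τ i))
    → ∀ i → extCls L k τ' (liftR L k ξ i) ≡ map₁ (liftR L k ρ) (extCls L k τ i)
  extCls-map₁ k {ρ} {ξ} τ τ' h = ≗-split k
    (λ a → trans (cong (extCls L k τ') (liftR-↑ˡ k a)) (trans (extCls-↑ˡ k τ' a)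
      (sym (trans (cong (map₁ (liftR L k ρ)) (extCls-↑ˡ k τ a)) (cong inj₁ (liftR-↑ˡ k a))))))
    (λ j → trans (cong (extCls L k τ') (liftR-↑ʳ k j)) (trans (extCls-↑ʳ k τ' (ξ j))
      (trans (cong (map₁ (k ↑ʳ_)) (h j))
        (sym (trans (cong (map₁ (liftR L k ρ)) (extCls-↑ʳ k τ j)) (liftR-map₁ (τ j)))))))
    where
    liftR-map₁ : ∀ z → map₁ (liftR L k ρ) (map₁ (k ↑ʳ_) z) ≡ map₁ (k ↑ʳ_) (map₁ ρ z)
    liftR-map₁ (inj₁ b) = cong inj₁ (liftR-↑ʳ k b)
    liftR-map₁ (inj₂ x) = refl

  mutual
    -- Shifts alone would not give an induction, since `r-fn` replaces u by a chain in each
    -- argument. `Renames` is closed under this step.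
    FT-renames : {u : Term L Ξ (sb q p)} {ρ : Fin p → Fin q} {ξ : Fin c → Fin c'}
        {τ : Fin c → Fin p ⊎ Var L Ξ (tm 0)} {τ' : Fin c' → Fin q ⊎ Var L Ξ (tm 0)}
      → Renames u ρ → (∀ i → τ' (ξ i) ≡ map₁ ρ (τ i))
      → ∀ t → FT L p τ t [ u ] ≅ FT L q τ' (renT L ξ t)
    FT-renames {ξ = ξ} {τ} {τ'} r h (var i) with τ i | τ' (ξ i) | h i
    ... | inj₁ b | _ | refl = on-cst r b
    ... | inj₂ x | _ | refl = rule r-clos ⨾ []-cong ≅-refl (on-⇑₀ r)
    FT-renames r h (app f as) = rule (r-fn f _ _) ⨾ conv (gmap (fn f _) fn-c (FA-renames r h as))

    FA-renames : {u : Term L Ξ (sb q p)} {ρ : Fin p → Fin q} {ξ : Fin c → Fin c'}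
        {τ : Fin c → Fin p ⊎ Var L Ξ (tm 0)} {τ' : Fin c' → Fin q ⊎ Var L Ξ (tm 0)}
      → Renames u ρ → (∀ i → τ' (ξ i) ≡ map₁ ρ (τ i))
      → ∀ {ks} (as : SArgs L c ks) → pushArgs L u ks (FA L p τ as) ≈s FA L q τ' (renA L ξ as)
    FA-renames r h [] = ε
    FA-renames {τ = τ} {τ'} r h (_∷_ {k} t as) =
      ∷-cong (≅⇒≈ (FT-renames (renames-chain r k) (extCls-map₁ k τ τ' h) t)) (FA-renames r h as)

  -- Pre-cooking under renaming and substitution of L' variables

  module _ (σ : ∀ {s} → Var L Ξ s → Term L Θ s) where

    subT'-⇑ : ∀ j m → subT' L σ (⇑ L j m) ≡ ⇑ L j m
    subT'-⇑ zero          m = refl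
    subT'-⇑ (suc zero)    m = refl
    subT'-⇑ (suc (suc j)) m = cong (↑ ∘_) (subT'-⇑ (suc j) (suc m))

    subT'-⇑₀ : ∀ m → subT' L σ (⇑₀ L m) ≡ ⇑₀ L m
    subT'-⇑₀ m = trans (subT'-subst (⊕-zero m) (⇑ L m 0))
      (cong (subst (λ N → Term L Θ (sb N 0)) (⊕-zero m)) (subT'-⇑ m 0))
      where
      subT'-subst : (e : n ≡ n') (u : Term L Ξ (sb n p))
        → subT' L σ (subst (λ N → Term L Ξ (sb N p)) e u) ≡ subst (λ N → Term L Θ (sb N p)) e (subT' L σ u)
      subT'-subst refl u = refl

  module _ (ρ : ∀ {s} → Var L Ξ s → Var L Θ s) where

    renT'-⇑ : ∀ j m → renT' L ρ (⇑ L j m) ≡ ⇑ L j m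
    renT'-⇑ zero          m = refl
    renT'-⇑ (suc zero)    m = refl
    renT'-⇑ (suc (suc j)) m = cong (↑ ∘_) (renT'-⇑ (suc j) (suc m))

    renT'-⇑₀ : ∀ m → renT' L ρ (⇑₀ L m) ≡ ⇑₀ L m
    renT'-⇑₀ m = trans (renT'-subst (⊕-zero m) (⇑ L m 0))
      (cong (subst (λ N → Term L Θ (sb N 0)) (⊕-zero m)) (renT'-⇑ m 0))
      where
      renT'-subst : (e : n ≡ n') (u : Term L Ξ (sb n p))
        → renT' L ρ (subst (λ N → Term L Ξ (sb N p)) e u) ≡ subst (λ N → Term L Θ (sb N p)) e (renT' L ρ u)
      renT'-subst refl u = refl

    extCls-map₂ : ∀ k {ξ : Fin c → Fin c'} (τ : Fin c → Fin p ⊎ Var L Ξ (tm 0)) (τ' : Fin c' → Fin p ⊎ Var L Θ (tm 0))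
      → (∀ i → map₂ ρ (τ i) ≡ τ' (ξ i)) → ∀ i → map₂ ρ (extCls L k τ i) ≡ extCls L k τ' (liftR L k ξ i)
    extCls-map₂ k {ξ} τ τ' h = ≗-split k
      (λ a → trans (cong (map₂ ρ) (extCls-↑ˡ k τ a))
        (sym (trans (cong (extCls L k τ') (liftR-↑ˡ k a)) (extCls-↑ˡ k τ' a))))
      (λ j → trans (cong (map₂ ρ) (extCls-↑ʳ k τ j)) (trans (map₁₂ (τ j)) (trans (cong (map₁ (k ↑ʳ_)) (h j))
        (sym (trans (cong (extCls L k τ') (liftR-↑ʳ k j)) (extCls-↑ʳ k τ' (ξ j)))))))
      where
      map₁₂ : ∀ z → map₂ ρ (map₁ (k ↑ʳ_) z) ≡ map₁ (k ↑ʳ_) (map₂ ρ z)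
      map₁₂ (inj₁ b) = refl
      map₁₂ (inj₂ x) = refl

    mutual
      renT'-FT : {ξ : Fin c → Fin c'} {τ : Fin c → Fin p ⊎ Var L Ξ (tm 0)} {τ' : Fin c' → Fin p ⊎ Var L Θ (tm 0)}
        → (∀ i → map₂ ρ (τ i) ≡ τ' (ξ i)) → ∀ t → renT' L ρ (FT L p τ t) ≡ FT L p τ' (renT L ξ t)
      renT'-FT {p = p} {ξ} {τ} {τ'} h (var i) with τ i | τ' (ξ i) | h i
      ... | inj₁ b | _ | refl = refl
      ... | inj₂ x | _ | refl = cong (var (ρ x) [_]) (renT'-⇑₀ p)
      renT'-FT h (app f as) = cong (fn f _) (renTs'-FA h as)

      renTs'-FA : {ξ : Fin c → Fin c'} {τ : Fin c → Fin p ⊎ Var L Ξ (tm 0)} {τ' : Fin c' → Fin p ⊎ Var L Θ (tm 0)}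
        → (∀ i → map₂ ρ (τ i) ≡ τ' (ξ i)) → ∀ {ks} (as : SArgs L c ks)
        → renTs' L ρ (FA L p τ as) ≡ FA L p τ' (renA L ξ as)
      renTs'-FA h [] = refl
      renTs'-FA {τ = τ} {τ'} h (_∷_ {k} t as) = cong₂ _∷_ (renT'-FT (extCls-map₂ k τ τ' h) t) (renTs'-FA h as)

  predCls-↑ˡ : ∀ k {τ : Fin c → Var L Ξ (tm 0)} a → predCls L k τ (a ↑ˡ c) ≡ inj₁ a
  predCls-↑ˡ k = copair-↑ˡ

  predCls-↑ʳ : ∀ k {τ : Fin c → Var L Ξ (tm 0)} j → predCls L k τ (k ↑ʳ j) ≡ inj₂ (τ j)
  predCls-↑ʳ k = copair-↑ʳ {k = k}

  predCls-map₂ : (ρ : ∀ {s} → Var L Ξ s → Var L Θ s)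
    → ∀ k {ξ : Fin c → Fin c'} {τ : Fin c → Var L Ξ (tm 0)} {τ' : Fin c' → Var L Θ (tm 0)}
    → (∀ i → ρ (τ i) ≡ τ' (ξ i)) → ∀ i → map₂ ρ (predCls L k τ i) ≡ predCls L k τ' (liftR L k ξ i)
  predCls-map₂ ρ k {ξ} {τ} {τ'} h = ≗-split k
    (λ a → trans (cong (map₂ ρ) (predCls-↑ˡ k a))
      (sym (trans (cong (predCls L k τ') (liftR-↑ˡ k a)) (predCls-↑ˡ k a))))
    (λ j → trans (cong (map₂ ρ) (predCls-↑ʳ k j)) (trans (cong inj₂ (h j))
      (sym (trans (cong (predCls L k τ') (liftR-↑ʳ k j)) (predCls-↑ʳ k (ξ j))))))

  renTs'-FPA : (ρ : ∀ {s} → Var L Ξ s → Var L Θ s) {ξ : Fin c → Fin c'}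
      {τ : Fin c → Var L Ξ (tm 0)} {τ' : Fin c' → Var L Θ (tm 0)}
    → (∀ i → ρ (τ i) ≡ τ' (ξ i)) → ∀ {ks} (as : SArgs L c ks) → renTs' L ρ (FPA L τ as) ≡ FPA L τ' (renA L ξ as)
  renTs'-FPA ρ h [] = refl
  renTs'-FPA ρ h (_∷_ {k} t as) = cong₂ _∷_ (renT'-FT ρ (predCls-map₂ ρ k h) t) (renTs'-FPA ρ h as)

  renF'-pre : (ρ : ∀ {s} → Var L (replicate n (tm 0)) s → Var L (replicate m (tm 0)) s) {ξ : Fin n → Fin m}
    → (∀ i → ρ (toVar L i) ≡ toVar L (ξ i)) → ∀ A → renF' L ρ (pre L A) ≡ pre L (renF L ξ A)
  renF'-pre ρ h (atom P as) = cong (atom P) (renTs'-FPA ρ h as)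
  renF'-pre ρ h (A ⊃ B)     = cong₂ _⊃_ (renF'-pre ρ h A) (renF'-pre ρ h B)
  renF'-pre ρ h (A ∧ B)     = cong₂ _∧_ (renF'-pre ρ h A) (renF'-pre ρ h B)
  renF'-pre ρ h (A ∨ B)     = cong₂ _∨_ (renF'-pre ρ h A) (renF'-pre ρ h B)
  renF'-pre ρ h ⊥           = refl
  renF'-pre ρ h (∀' A)      = cong (∀' _) (renF'-pre (liftV L ρ) (λ { zero → refl ; (suc i) → cong vs (h i) }) A)
  renF'-pre ρ h (∃' A)      = cong (∃' _) (renF'-pre (liftV L ρ) (λ { zero → refl ; (suc i) → cong vs (h i) }) A)

  wkT-pre : (A : SForm L n) → wkT L (pre L A) ≡ pre L (wkS L A)
  wkT-pre = renF'-pre vs (λ _ → refl)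

  module _ (σ' : ∀ {s} → Var L Ξ s → Term L Θ s) where

    -- Under k further binders the source weakens the image of an outer variable, while on the L'
    -- side its shift grows by ↑^k. `FT-renames` for this shift identifies the two.
    extCls-agrees : ∀ k (τ : Fin c → Fin p ⊎ Var L Ξ (tm 0)) (τ' : Fin c' → Fin p ⊎ Var L Θ (tm 0))
        {σ : Fin c → STm L c'}
      → (∀ i → subT' L σ' (FT L p τ (var i)) ≅ FT L p τ' (σ i))
      → ∀ i → subT' L σ' (FT L (k + p) (extCls L k τ) (var i)) ≅ FT L (k + p) (extCls L k τ') (liftS L k σ i)
    extCls-agrees {p = p} k τ τ' {σ} h i with split k i
    ... | left a rewrite extCls-↑ˡ k τ a | liftS-↑ˡ k {σ} a | extCls-↑ˡ k τ' a = ≅-refl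
    ... | right j rewrite extCls-↑ʳ k τ j | liftS-↑ʳ k {σ} j = weakened (τ j) (h j)
        ⨾ FT-renames (renames-up k) (extCls-↑ʳ k τ') (σ j)
      where
      cook : ∀ p → Fin p ⊎ Var L Ξ (tm 0) → Term L Ξ (tm p)
      cook p = [ cst , (λ x → (var x) [ ⇑₀ L p ]) ]′

      weakened : ∀ z {t} → subT' L σ' (cook p z) ≅ t → subT' L σ' (cook (k + p) (map₁ (k ↑ʳ_) z)) ≅ t [ up k p ]
      weakened (inj₁ b) e = ≅-sym (cst-up k b) ⨾ []-cong e ≅-refl
      weakened (inj₂ x) e =
        []-cong ≅-refl (≡⇒≅ (subT'-⇑₀ σ' (k + p)) ⨾ ≅-sym (⇑₀∘up p k))
        ⨾ ≅-sym (rule r-clos)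
        ⨾ []-cong ([]-cong ≅-refl (≅-sym (≡⇒≅ (subT'-⇑₀ σ' p))) ⨾ e) ≅-refl

    mutual
      subT'-FT : {τ : Fin c → Fin p ⊎ Var L Ξ (tm 0)} {τ' : Fin c' → Fin p ⊎ Var L Θ (tm 0)} {σ : Fin c → STm L c'}
        → (∀ i → subT' L σ' (FT L p τ (var i)) ≅ FT L p τ' (σ i))
        → ∀ t → subT' L σ' (FT L p τ t) ≅ FT L p τ' (subT L σ t)
      subT'-FT h (var i)    = h i
      subT'-FT h (app f as) = conv (gmap (fn f _) fn-c (subTs'-FA h as))

      subTs'-FA : {τ : Fin c → Fin p ⊎ Var L Ξ (tm 0)} {τ' : Fin c' → Fin p ⊎ Var L Θ (tm 0)} {σ : Fin c → STm L c'}
        → (∀ i → subT' L σ' (FT L p τ (var i)) ≅ FT L p τ' (σ i))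
        → ∀ {ks} (as : SArgs L c ks) → subTs' L σ' (FA L p τ as) ≈s FA L p τ' (subA L σ as)
      subTs'-FA h [] = ε
      subTs'-FA {τ = τ} {τ'} h (_∷_ {k} t as) = ∷-cong (≅⇒≈ (subT'-FT (extCls-agrees k τ τ' h) t)) (subTs'-FA h as)

    -- A predicate passes from sort 0 to sort k in one step, so the substituted term stands below
    -- the whole shift `⇑₀ k`, which renames an empty set of constants.
    predCls-agrees : ∀ k {τ : Fin c → Var L Ξ (tm 0)} {τ' : Fin c' → Var L Θ (tm 0)} {σ : Fin c → STm L c'}
      → (∀ i → σ' (τ i) ≅ FT L 0 (λ i → inj₂ (τ' i)) (σ i))
      → ∀ i → subT' L σ' (FT L k (predCls L k τ) (var i)) ≅ FT L k (predCls L k τ') (liftS L k σ i)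
    predCls-agrees k {τ} {τ'} {σ} h i with split k i
    ... | left a rewrite predCls-↑ˡ k {τ} a | liftS-↑ˡ k {σ} a | predCls-↑ˡ k {τ'} a = ≅-refl
    ... | right j rewrite predCls-↑ʳ k {τ} j | liftS-↑ʳ k {σ} j =
        []-cong (h j) (≡⇒≅ (subT'-⇑₀ σ' k)) ⨾ FT-renames (renames-⇑₀ k) (λ i → predCls-↑ʳ k i) (σ j)

    subTs'-FPA : {τ : Fin c → Var L Ξ (tm 0)} {τ' : Fin c' → Var L Θ (tm 0)} {σ : Fin c → STm L c'}
      → (∀ i → σ' (τ i) ≅ FT L 0 (λ i → inj₂ (τ' i)) (σ i))
      → ∀ {ks} (as : SArgs L c ks) → subTs' L σ' (FPA L τ as) ≈s FPA L τ' (subA L σ as)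
    subTs'-FPA h [] = ε
    subTs'-FPA h (_∷_ {k} t as) = ∷-cong (≅⇒≈ (subT'-FT (predCls-agrees k h) t)) (subTs'-FPA h as)

  preT : STm L n → Term L (replicate n (tm 0)) (tm 0)
  preT = FT L 0 (λ i → inj₂ (toVar L i))

  -- Pre-cooking turns a variable x into x [ id ] whereas instantiation leaves the
  -- other variables untouched; both forms are stable under liftσ.
  PreCooked : Term L (replicate n (tm 0)) (tm 0) → STm L n → Set
  PreCooked u t = u ≡ preT t ⊎ (∃[ i ] u ≡ var (toVar L i) × t ≡ var i)

  preCooked⇒≅ : {u : Term L (replicate n (tm 0)) (tm 0)} {t : STm L n} → PreCooked u t → u ≅ preT t
  preCooked⇒≅ (inj₁ e)                 = ≡⇒≅ e
  preCooked⇒≅ (inj₂ (i , refl , refl)) = ≅-sym (rule r-id)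

  preCooked-suc : {u : Term L (replicate n (tm 0)) (tm 0)} {t : STm L n}
    → PreCooked u t → PreCooked {suc n} (renT' L vs u) (renT L suc t)
  preCooked-suc {t = t} (inj₁ refl)    = inj₁ (renT'-FT vs (λ _ → refl) t)
  preCooked-suc (inj₂ (i , refl , refl)) = inj₂ (suc i , refl , refl)

  liftσ-preCooked : (σ' : ∀ {s} → Var L (replicate n (tm 0)) s → Term L (replicate m (tm 0)) s) {σ : Fin n → STm L m}
    → (∀ i → PreCooked (σ' (toVar L i)) (σ i)) → ∀ i → PreCooked {suc m} (liftσ L σ' (toVar L i)) (liftS L 1 σ i)
  liftσ-preCooked σ' h zero    = inj₂ (zero , refl , refl)
  liftσ-preCooked σ' h (suc i) = preCooked-suc (h i)

  subF'-pre : (σ' : ∀ {s} → Var L (replicate n (tm 0)) s → Term L (replicate m (tm 0)) s) {σ : Fin n → STm L m}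
    → (∀ i → PreCooked (σ' (toVar L i)) (σ i)) → ∀ A → _≡σ_ L (subF' L σ' (pre L A)) (pre L (subF L σ A))
  subF'-pre σ' h (atom P as) = gmap (atom P) atom-c (subTs'-FPA σ' (λ i → preCooked⇒≅ (h i)) as)
  subF'-pre σ' h (A ⊃ B)     = gmap (_⊃ _) ⊃₁ (subF'-pre σ' h A) ◅◅ gmap (_ ⊃_) ⊃₂ (subF'-pre σ' h B)
  subF'-pre σ' h (A ∧ B)     = gmap (_∧ _) ∧₁ (subF'-pre σ' h A) ◅◅ gmap (_ ∧_) ∧₂ (subF'-pre σ' h B)
  subF'-pre σ' h (A ∨ B)     = gmap (_∨ _) ∨₁ (subF'-pre σ' h A) ◅◅ gmap (_ ∨_) ∨₂ (subF'-pre σ' h B)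
  subF'-pre σ' h ⊥           = ε
  subF'-pre σ' h (∀' A)      = gmap (∀' _) ∀-c (subF'-pre (liftσ L σ') (liftσ-preCooked σ' h) A)
  subF'-pre σ' h (∃' A)      = gmap (∃' _) ∃-c (subF'-pre (liftσ L σ') (liftσ-preCooked σ' h) A)

  -- This holds only modulo σ: instantiation leaves `preT t` below a shift at each occurrence,
  -- whereas pre-cooking the instance has the shift already carried to the leaves of t.
  pre-inst : ∀ (A : SForm L (suc n)) t → _≡σ_ L (pre L (instS L A t)) (instT L (pre L A) (preT t))
  pre-inst A t = symmetric _ (subF'-pre _ (λ { zero → inj₁ refl ; (suc i) → inj₂ (i , refl , refl) }) A)

  map-wk-pre : (Γ : List (SForm L n)) → map (pre L) (map (wkS L) Γ) ≡ map (wkT L) (map (pre L) Γ)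
  map-wk-pre Γ = trans (sym (map-∘ Γ)) (trans (map-cong (λ A → sym (wkT-pre A)) Γ) (map-∘ Γ))

  -- Translation of LK derivations

  LK⇒LKσ : {Γ Δ : List (SForm L n)} → LK L n Γ Δ → LKσ L (replicate n (tm 0)) (map (pre L) Γ) (map (pre L) Δ)
  LK⇒LKσ ax            = ax ε
  LK⇒LKσ (cut A d d')  = cut ε (LK⇒LKσ d) (LK⇒LKσ d')
  LK⇒LKσ (contrL d)    = contrL ε ε (LK⇒LKσ d)
  LK⇒LKσ (contrR d)    = contrR ε ε (LK⇒LKσ d)
  LK⇒LKσ (weakL d)     = weakL (LK⇒LKσ d)
  LK⇒LKσ (weakR d)     = weakR (LK⇒LKσ d)
  LK⇒LKσ (exch p q d)  = exch (map⁺ (pre L) p) (map⁺ (pre L) q) (LK⇒LKσ d)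
  LK⇒LKσ (⊃L d d')     = ⊃L ε (LK⇒LKσ d) (LK⇒LKσ d')
  LK⇒LKσ (⊃R d)        = ⊃R ε (LK⇒LKσ d)
  LK⇒LKσ (∧L d)        = ∧L ε (LK⇒LKσ d)
  LK⇒LKσ (∧R d d')     = ∧R ε (LK⇒LKσ d) (LK⇒LKσ d')
  LK⇒LKσ (∨L d d')     = ∨L ε (LK⇒LKσ d) (LK⇒LKσ d')
  LK⇒LKσ (∨R d)        = ∨R ε (LK⇒LKσ d)
  LK⇒LKσ ⊥L            = ⊥L ε
  LK⇒LKσ (∀L {A = A} t d) = ∀L (preT t) ε (pre-inst A t) (LK⇒LKσ d)
  LK⇒LKσ (∀R {Γ = Γ} {Δ} d) =
    ∀R ε (subst₂ (LKσ L _) (map-wk-pre Γ) (cong (_ ∷_) (map-wk-pre Δ)) (LK⇒LKσ d))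
  LK⇒LKσ (∃L {Γ = Γ} {Δ} d) =
    ∃L ε (subst₂ (LKσ L _) (cong (_ ∷_) (map-wk-pre Γ)) (map-wk-pre Δ) (LK⇒LKσ d))
  LK⇒LKσ (∃R {A = A} t d) = ∃R (preT t) ε (pre-inst A t) (LK⇒LKσ d)
  LK⇒LKσ (fresh {Γ = Γ} {Δ} d) = fresh (tm 0) (subst₂ (LKσ L _) (map-wk-pre Γ) (map-wk-pre Δ) (LK⇒LKσ d))

theorem1 : (L : Lang) (n : ℕ) (Γ Δ : List (SForm L n))
    → LK L n Γ Δ ⇔ LKσ L (replicate n (tm 0)) (map (pre L) Γ) (map (pre L) Δ)
theorem1 L n Γ Δ = mk⇔ (LK⇒LKσ L) (LKσ⇒LK L Γ Δ)
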